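{- Let $S(\bar p,q)=\big[t(\bar p,q)=\mathbf 1\wedge\bigwedge_{k\le\kappa}s_k(\bar p,q)\neq\mathbf 1\big]$ be a system of degree $\le d$, with $\bar p=(p_1,\dots,p_l)$. For every $l$-tuple $\bar a$ in a Heyting algebra $A$, the system $S(\bar a,q)$ has a solution in some Heyting algebra extending $A$ if and only if $\Delta_t(\bar a)=\mathbf 1$ and $\nabla_{t,s_k}(\bar a)\neq\mathbf 1$ for every $k\le\kappa$.
   Context: $F(\bar p)\subseteq F(\bar p,q)$ are free Heyting algebras; IPC formulas are identified with their elements; degree = maximal nesting of $\to$. A system of degree $\le d$ means $t,s_k$ all have degree $\le d$; a solution of $S(\bar a,q)$ in $B\supseteq A$ is $b\in B$ with $t(\bar a,b)=\mathbf 1$ and $s_k(\bar a,b)\ne\mathbf 1$ for all $k$. $\mathrm{Es}(\bar p)$ is the set of prime filters of $F(\bar p)$; $[\![\varphi]\!]=\{x\in\mathrm{Es}(\bar p):\varphi\in x\}$. $x\sim_n y$ means $x,y$ contain the same formulas of degree $\le n$; $\delta_{\bar p}(x,y)=2^{ -\min\{n:x\not\sim_n y\}}$, similarly $\delta_{\bar p,q}$ on $\mathrm{Es}(\bar p,q)$. The balls of radius $2^{ -n}$ in $\mathrm{Es}(\bar p)$ are the $\sim_n$-classes; for each such ball $B$ a pair $(\varphi_B,\psi_B)$ of IPC formulas in $\bar p$ of degree $<n$ with $B=[\![\varphi_B]\!]\setminus[\![\psi_B]\!]$ is fixed. $R_{l,d}$ is a fixed integer such that for all $y\in\mathrm{Es}(\bar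 p)$, $x_0\in\mathrm{Es}(\bar p,q)$ with $\delta_{\bar p}(y,x_0\cap F(\bar p))<2^{ -R_{l,d}}$ there is $x\in\mathrm{Es}(\bar p,q)$ with $x\cap F(\bar p)=y$ and $\delta_{\bar p,q}(x,x_0)<2^{ -d}$ (such an integer exists). Discriminant: $\Delta_t(\bar p)=\bigwedge_{B\in\mathcal D_t}(\varphi_B(\bar p)\to\psi_B(\bar p))$, where $\mathcal D_t$ is the set of balls $B$ of radius $2^{ -R_{l,d}}$ in $\mathrm{Es}(\bar p)$ with $t(\bar p,q)\wedge\varphi_B(\bar p)\le\psi_B(\bar p)$ in $F(\bar p,q)$. Co-discriminant: $\nabla_{t,s_k}(\bar p)=\bigwedge_{B\in\mathcal D'_{t,s_k}}(\varphi_B(\bar p)\to\psi_B(\bar p))$, where $\mathcal D'_{t,s_k}$ is the set of balls $B$ of radius $2^{ -R_{l,d}}$ with $t(\bar p,q)\wedge\varphi_B(\bar p)\not\le s_k(\bar p,q)\vee\psi_B(\bar p)$ in $F(\bar p,q)$. -}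

module Defs where

open import Level using (Level; _⊔_; Setω) renaming (suc to lsuc)
open import Data.Nat using (ℕ; zero; suc; _≤_; _<_) renaming (_⊔_ to _⊔ₙ_)
open import Data.Fin using (Fin; zero; suc)
open import Data.List using (List; []; _∷_; foldr)
open import Data.List.Membership.Propositional using (_∈_)
open import Data.Product using (Σ; _×_; _,_; ∃)
open import Relation.Nullary using (¬_)
open import Function.Bundles using (_⇔_)
open import Data.Sum using (_⊎_)
open import Relation.Binary.Lattice.Bundles using (HeytingAlgebra)

infixr 7 _∧ᶠ_
infixr 6 _∨ᶠ_
infixr 5 _⇒ᶠ_

data Formula (n : ℕ) : Set where
  var        : Fin n → Formula n
  ⊤ᶠ ⊥ᶠ      : Formula n
  _∧ᶠ_ _∨ᶠ_ _⇒ᶠ_ : Formula n → Formula n → Formula n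

deg : ∀ {n} → Formula n → ℕ
deg (var _)   = 0
deg ⊤ᶠ        = 0
deg ⊥ᶠ        = 0
deg (φ ∧ᶠ ψ)  = deg φ ⊔ₙ deg ψ
deg (φ ∨ᶠ ψ)  = deg φ ⊔ₙ deg ψ
deg (φ ⇒ᶠ ψ)  = suc (deg φ ⊔ₙ deg ψ)

-- Variables of F(p̄,q): index zero is q, index (suc i) is p_i.
-- ι embeds F(p̄) into F(p̄,q).
ι : ∀ {n} → Formula n → Formula (suc n)
ι (var i)  = var (suc i)
ι ⊤ᶠ       = ⊤ᶠ
ι ⊥ᶠ       = ⊥ᶠ
ι (φ ∧ᶠ ψ) = ι φ ∧ᶠ ι ψ
ι (φ ∨ᶠ ψ) = ι φ ∨ᶠ ι ψ
ι (φ ⇒ᶠ ψ) = ι φ ⇒ᶠ ι ψ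

-- IPC (natural deduction); this gives the order of the free Heyting
-- algebra F(n): φ ≤ ψ iff φ ⊢ ψ.

infix 3 _⊢_

data _⊢_ {n : ℕ} : List (Formula n) → Formula n → Set where
  hyp  : ∀ {Γ φ} → φ ∈ Γ → Γ ⊢ φ
  ⊤I   : ∀ {Γ} → Γ ⊢ ⊤ᶠ
  ⊥E   : ∀ {Γ φ} → Γ ⊢ ⊥ᶠ → Γ ⊢ φ
  ∧I   : ∀ {Γ φ ψ} → Γ ⊢ φ → Γ ⊢ ψ → Γ ⊢ φ ∧ᶠ ψ
  ∧E₁  : ∀ {Γ φ ψ} → Γ ⊢ φ ∧ᶠ ψ → Γ ⊢ φ
  ∧E₂  : ∀ {Γ φ ψ} → Γ ⊢ φ ∧ᶠ ψ → Γ ⊢ ψ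
  ∨I₁  : ∀ {Γ φ ψ} → Γ ⊢ φ → Γ ⊢ φ ∨ᶠ ψ
  ∨I₂  : ∀ {Γ φ ψ} → Γ ⊢ ψ → Γ ⊢ φ ∨ᶠ ψ
  ∨E   : ∀ {Γ φ ψ χ} → Γ ⊢ φ ∨ᶠ ψ → φ ∷ Γ ⊢ χ → ψ ∷ Γ ⊢ χ → Γ ⊢ χ
  ⇒I   : ∀ {Γ φ ψ} → φ ∷ Γ ⊢ ψ → Γ ⊢ φ ⇒ᶠ ψ
  ⇒E   : ∀ {Γ φ ψ} → Γ ⊢ φ ⇒ᶠ ψ → Γ ⊢ φ → Γ ⊢ ψ

_≤F_ : ∀ {n} → Formula n → Formula n → Set
φ ≤F ψ = (φ ∷ []) ⊢ ψ

record Es (n : ℕ) : Set₁ where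
  field
    _∋_     : Formula n → Set
    upward  : ∀ {φ ψ} → φ ≤F ψ → _∋_ φ → _∋_ ψ
    top     : _∋_ ⊤ᶠ
    meet    : ∀ {φ ψ} → _∋_ φ → _∋_ ψ → _∋_ (φ ∧ᶠ ψ)
    proper  : ¬ (_∋_ ⊥ᶠ)
    prime   : ∀ {φ ψ} → _∋_ (φ ∨ᶠ ψ) → (_∋_ φ) ⊎ (_∋_ ψ)
open Es public

-- x ∼⟨ m ⟩ y : x and y contain the same formulas of degree ≤ m
-- (equivalently δ(x,y) < 2^{-m})
_∼⟨_⟩_ : ∀ {n} → Es n → ℕ → Es n → Set
x ∼⟨ m ⟩ y = ∀ φ → deg φ ≤ m → ((x ∋ φ) ⇔ (y ∋ φ))

Restr∼ : ∀ {n} → ℕ → Es (suc n) → Es n → Set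
Restr∼ m x y = ∀ φ → deg φ ≤ m → ((x ∋ ι φ) ⇔ (y ∋ φ))

Restr : ∀ {n} → Es (suc n) → Es n → Set
Restr x y = ∀ φ → ((x ∋ ι φ) ⇔ (y ∋ φ))

IsR : ℕ → ℕ → ℕ → Set₁
IsR l d R = ∀ (y : Es l) (x₀ : Es (suc l)) → Restr∼ R x₀ y →
            Σ (Es (suc l)) λ x → Restr x y × (x ∼⟨ d ⟩ x₀)

_∈⟦_∖_⟧ : ∀ {n} → Es n → Formula n → Formula n → Set
x ∈⟦ φ ∖ ψ ⟧ = (x ∋ φ) × ¬ (x ∋ ψ)

-- (φ,ψ) presents a ball of radius 2^{-R}, i.e. a ∼⟨ R ⟩-class
IsBall : ∀ {n} → ℕ → Formula n × Formula n → Set₁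
IsBall {n} R (φ , ψ) =
  deg φ ≤ R × deg ψ ≤ R ×
  Σ (Es n) λ x₀ → ∀ (x : Es n) → (x ∈⟦ φ ∖ ψ ⟧) ⇔ (x ∼⟨ R ⟩ x₀)

BallSystem : (n R : ℕ) → List (Formula n × Formula n) → Set₁
BallSystem n R balls =
  (∀ {e} → e ∈ balls → IsBall R e) ×
  (∀ (x : Es n) → Σ (Formula n × Formula n) λ e →
      e ∈ balls × x ∈⟦ Data.Product.proj₁ e ∖ Data.Product.proj₂ e ⟧)

IsDiscList : ∀ {n} → List (Formula n × Formula n) → Formula (suc n) →
             List (Formula n × Formula n) → Set
IsDiscList balls t Dt = ∀ φ ψ →
  ((φ , ψ) ∈ Dt) ⇔ (((φ , ψ) ∈ balls) × ((t ∧ᶠ ι φ) ≤F ι ψ))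

IsCoDiscList : ∀ {n} → List (Formula n × Formula n) → Formula (suc n) →
               Formula (suc n) → List (Formula n × Formula n) → Set
IsCoDiscList balls t s D' = ∀ φ ψ →
  ((φ , ψ) ∈ D') ⇔ (((φ , ψ) ∈ balls) × ¬ ((t ∧ᶠ ι φ) ≤F (s ∨ᶠ ι ψ)))

⋀⇒ : ∀ {n} → List (Formula n × Formula n) → Formula n
⋀⇒ []            = ⊤ᶠ
⋀⇒ ((φ , ψ) ∷ D) = (φ ⇒ᶠ ψ) ∧ᶠ ⋀⇒ D

module _ {c ℓ₁ ℓ₂} (H : HeytingAlgebra c ℓ₁ ℓ₂) where
  open HeytingAlgebra H

  ⟦_⟧ : ∀ {n} → Formula n → (Fin n → Carrier) → Carrier
  ⟦ var i ⟧  v = v i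
  ⟦ ⊤ᶠ ⟧     v = ⊤
  ⟦ ⊥ᶠ ⟧     v = ⊥
  ⟦ φ ∧ᶠ ψ ⟧ v = ⟦ φ ⟧ v ∧ ⟦ ψ ⟧ v
  ⟦ φ ∨ᶠ ψ ⟧ v = ⟦ φ ⟧ v ∨ ⟦ ψ ⟧ v
  ⟦ φ ⇒ᶠ ψ ⟧ v = ⟦ φ ⟧ v ⇨ ⟦ ψ ⟧ v

record Embedding {c ℓ₁ ℓ₂ c' ℓ₁' ℓ₂'}
                 (A : HeytingAlgebra c ℓ₁ ℓ₂)
                 (B : HeytingAlgebra c' ℓ₁' ℓ₂')
                 : Set (c ⊔ ℓ₁ ⊔ ℓ₂ ⊔ c' ⊔ ℓ₁' ⊔ ℓ₂') where
  private
    module A = HeytingAlgebra A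
    module B = HeytingAlgebra B
  field
    f       : A.Carrier → B.Carrier
    cong    : ∀ {x y} → x A.≈ y → f x B.≈ f y
    injective : ∀ {x y} → f x B.≈ f y → x A.≈ y
    pres-∧  : ∀ x y → f (x A.∧ y) B.≈ (f x B.∧ f y)
    pres-∨  : ∀ x y → f (x A.∨ y) B.≈ (f x B.∨ f y)
    pres-⇨  : ∀ x y → f (x A.⇨ y) B.≈ (f x B.⇨ f y)
    pres-⊤  : f A.⊤ B.≈ B.⊤
    pres-⊥  : f A.⊥ B.≈ B.⊥

-- S(ā,q) has a solution in some Heyting algebra extending A
-- (the extension may live in any universe, hence Setω)

extVal : ∀ {c ℓ₁ ℓ₂ c' ℓ₁' ℓ₂'} {l : ℕ}
         {A : HeytingAlgebra c ℓ₁ ℓ₂} {B : HeytingAlgebra c' ℓ₁' ℓ₂'} →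
         Embedding A B → (Fin l → HeytingAlgebra.Carrier A) →
         HeytingAlgebra.Carrier B → Fin (suc l) → HeytingAlgebra.Carrier B
extVal emb a b zero    = b
extVal emb a b (suc i) = Embedding.f emb (a i)

record HasSolution {c ℓ₁ ℓ₂} {l κ : ℕ}
                   (A : HeytingAlgebra c ℓ₁ ℓ₂)
                   (a : Fin l → HeytingAlgebra.Carrier A)
                   (t : Formula (suc l)) (s : Fin (suc κ) → Formula (suc l))
                   : Setω where
  field
    {c' ℓ₁' ℓ₂'} : Level
    B     : HeytingAlgebra c' ℓ₁' ℓ₂'
    emb   : Embedding A B
    b     : HeytingAlgebra.Carrier B
    t-sol : HeytingAlgebra._≈_ B (⟦ B ⟧ t (extVal emb a b)) (HeytingAlgebra.⊤ B)
    s-sol : ∀ k → ¬ (HeytingAlgebra._≈_ B (⟦ B ⟧ (s k) (extVal emb a b)) (HeytingAlgebra.⊤ B))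

record _⇔ω_ {ℓ} (P : Setω) (Q : Set ℓ) : Setω where
  field
    to   : P → Q
    from : Q → P

{-# OPTIONS --safe #-}

-- Δ_t is the uniform interpolant ∃q t: it is the least θ(p̄) above t.  If Δ_t ≰ θ, a prime filter y
-- separates them; y lies in a ball B outside 𝒟_t, so some x₀ ∋ t restricts into B, and R_{l,d} turns
-- x₀ into an x ∋ t restricting to y, whence t ≰ θ.  Dually ∇_{t,s} is ∀q (t → s).  Separating prime
-- filters come from a terminating proof search that returns a derivation or a finite Kripke model.
--
-- The extension of A is the Lindenbaum algebra of the diagram of A together with t(ā,q).  By cut
-- elimination, whatever it proves about A factors through an interpolant I(p̄) with t ≤ I, and
-- whenever it proves s(ā,q) there is an I(p̄) with A ⊨ I(ā) and t ∧ I ≤ s.  Uniformity then gives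
-- Δ_t ≤ I, resp. I ≤ ∇_{t,s}, so that A embeds if Δ_t(ā) = 1 and s(ā,q) ≠ 1 if ∇_{t,s}(ā) ≠ 1.
module Submission where

open import Defs
open import Level using (Level) renaming (_⊔_ to _⊔ℓ_)
open import Data.Empty using (⊥-elim) renaming (⊥ to Empty)
open import Data.Empty.Polymorphic using () renaming (⊥ to EmptyP)
open import Data.Fin using (Fin; zero; suc)
import Data.Fin.Properties as Fin
open import Data.List using (List; []; _∷_; _++_; foldr; map)
open import Data.List.Membership.Propositional using (_∈_; _∉_)
open import Data.List.Membership.Propositional.Properties using (∈-map⁺; ∈-++⁺ˡ; ∈-++⁺ʳ; ∈-++⁻)
import Data.List.Membership.DecPropositional as DecMembership
open import Data.List.Relation.Binary.Subset.Propositional using (_⊆_)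
open import Data.List.Relation.Binary.Subset.Propositional.Properties using (∷⁺ʳ; ∈-∷⁺ʳ)
open import Data.List.Relation.Unary.All using (All; []; _∷_; lookup)
open import Data.List.Relation.Unary.Any using (here; there)
open import Data.Maybe using (Maybe; just; nothing)
open import Data.Nat using (ℕ; zero; suc; _≤_; _<_; z≤n; s≤s; s≤s⁻¹)
import Data.Nat.Properties as ℕ
open import Data.Product using (_×_; _,_; proj₁; proj₂; ∃₂; Σ-syntax; swap)
open import Data.Sum using (_⊎_; inj₁; inj₂; [_,_]′)
open import Data.Unit using (tt) renaming (⊤ to Unit)
open import Data.Unit.Polymorphic using () renaming (⊤ to UnitP)
open import Function using (_∘_; id)
open import Function.Bundles using (Equivalence; mk⇔)
open import Relation.Binary.Definitions using (DecidableEquality)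
open import Relation.Binary.Lattice.Bundles using (HeytingAlgebra)
import Relation.Binary.Lattice.Properties.HeytingAlgebra as HeytingProperties
import Relation.Binary.Lattice.Properties.JoinSemilattice as JoinProperties
import Relation.Binary.Lattice.Properties.MeetSemilattice as MeetProperties
open import Relation.Binary.PropositionalEquality as ≡ using (_≡_; refl)
open import Relation.Nullary using (¬_; Dec; yes; no; contradiction)
open import Relation.Nullary.Decidable using (map′; _×-dec_)
open Equivalence using (to; from)

private variable
  n l d R : ℕ
  φ ψ χ θ : Formula n
  Γ Γ′ Δ Δ′ : List (Formula n)

-- Weakening, cut and disjunctive goals in natural deduction

weaken : Γ ⊆ Δ → Γ ⊢ φ → Δ ⊢ φ
weaken ρ (hyp m)      = hyp (ρ m)
weaken ρ ⊤I           = ⊤I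
weaken ρ (⊥E d)       = ⊥E (weaken ρ d)
weaken ρ (∧I d e)     = ∧I (weaken ρ d) (weaken ρ e)
weaken ρ (∧E₁ d)      = ∧E₁ (weaken ρ d)
weaken ρ (∧E₂ d)      = ∧E₂ (weaken ρ d)
weaken ρ (∨I₁ d)      = ∨I₁ (weaken ρ d)
weaken ρ (∨I₂ d)      = ∨I₂ (weaken ρ d)
weaken ρ (∨E d e₁ e₂) = ∨E (weaken ρ d) (weaken (∷⁺ʳ _ ρ) e₁) (weaken (∷⁺ʳ _ ρ) e₂)
weaken ρ (⇒I d)       = ⇒I (weaken (∷⁺ʳ _ ρ) d)
weaken ρ (⇒E d e)     = ⇒E (weaken ρ d) (weaken ρ e)

weaken₁ : Γ ⊢ φ → ψ ∷ Γ ⊢ φ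
weaken₁ = weaken there

cut⊢ : Γ ⊢ φ → φ ∷ Γ ⊢ ψ → Γ ⊢ ψ
cut⊢ d e = ⇒E (⇒I e) d

ι-⊢ : Γ ⊢ φ → map ι Γ ⊢ ι φ
ι-⊢ (hyp m)      = hyp (∈-map⁺ ι m)
ι-⊢ ⊤I           = ⊤I
ι-⊢ (⊥E d)       = ⊥E (ι-⊢ d)
ι-⊢ (∧I d e)     = ∧I (ι-⊢ d) (ι-⊢ e)
ι-⊢ (∧E₁ d)      = ∧E₁ (ι-⊢ d)
ι-⊢ (∧E₂ d)      = ∧E₂ (ι-⊢ d)
ι-⊢ (∨I₁ d)      = ∨I₁ (ι-⊢ d)
ι-⊢ (∨I₂ d)      = ∨I₂ (ι-⊢ d)
ι-⊢ (∨E d e₁ e₂) = ∨E (ι-⊢ d) (ι-⊢ e₁) (ι-⊢ e₂)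
ι-⊢ (⇒I d)       = ⇒I (ι-⊢ d)
ι-⊢ (⇒E d e)     = ⇒E (ι-⊢ d) (ι-⊢ e)

-- Reads the right side of a multi-conclusion sequent as a single goal, with `⊥ᶠ` for the empty
-- side.
⋁ : List (Formula n) → Formula n
⋁ = foldr _∨ᶠ_ ⊥ᶠ

⋁-intro : φ ∈ Δ → Γ ⊢ φ → Γ ⊢ ⋁ Δ
⋁-intro (here refl) d = ∨I₁ d
⋁-intro (there m)   d = ∨I₂ (⋁-intro m d)

-- With `χ = ⋁ Δ`, the disjunction is definitionally `⋁ (φ ∷ Δ)`, so this removes a formula that the
-- proof search added on the right.
∨-absorb : φ ∷ Γ ⊢ χ → Γ ⊢ φ ∨ᶠ χ → Γ ⊢ χ
∨-absorb e d = ∨E d e (hyp (here refl))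

-- Decidable equality and subformula closure

infix 4 _≟_

_≟_ : DecidableEquality (Formula n)
var i    ≟ var j    = map′ (≡.cong var) (λ { refl → refl }) (i Fin.≟ j)
var _    ≟ ⊤ᶠ       = no λ ()
var _    ≟ ⊥ᶠ       = no λ ()
var _    ≟ (_ ∧ᶠ _) = no λ ()
var _    ≟ (_ ∨ᶠ _) = no λ ()
var _    ≟ (_ ⇒ᶠ _) = no λ ()
⊤ᶠ       ≟ ⊤ᶠ       = yes refl
⊤ᶠ       ≟ var _    = no λ ()
⊤ᶠ       ≟ ⊥ᶠ       = no λ ()
⊤ᶠ       ≟ (_ ∧ᶠ _) = no λ ()
⊤ᶠ       ≟ (_ ∨ᶠ _) = no λ ()
⊤ᶠ       ≟ (_ ⇒ᶠ _) = no λ ()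
⊥ᶠ       ≟ ⊥ᶠ       = yes refl
⊥ᶠ       ≟ var _    = no λ ()
⊥ᶠ       ≟ ⊤ᶠ       = no λ ()
⊥ᶠ       ≟ (_ ∧ᶠ _) = no λ ()
⊥ᶠ       ≟ (_ ∨ᶠ _) = no λ ()
⊥ᶠ       ≟ (_ ⇒ᶠ _) = no λ ()
(φ ∧ᶠ ψ) ≟ (χ ∧ᶠ ω) = map′ (λ { (p , q) → ≡.cong₂ _∧ᶠ_ p q }) (λ { refl → refl , refl }) ((φ ≟ χ) ×-dec (ψ ≟ ω))
(_ ∧ᶠ _) ≟ var _    = no λ ()
(_ ∧ᶠ _) ≟ ⊤ᶠ       = no λ ()
(_ ∧ᶠ _) ≟ ⊥ᶠ       = no λ ()
(_ ∧ᶠ _) ≟ (_ ∨ᶠ _) = no λ ()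
(_ ∧ᶠ _) ≟ (_ ⇒ᶠ _) = no λ ()
(φ ∨ᶠ ψ) ≟ (χ ∨ᶠ ω) = map′ (λ { (p , q) → ≡.cong₂ _∨ᶠ_ p q }) (λ { refl → refl , refl }) ((φ ≟ χ) ×-dec (ψ ≟ ω))
(_ ∨ᶠ _) ≟ var _    = no λ ()
(_ ∨ᶠ _) ≟ ⊤ᶠ       = no λ ()
(_ ∨ᶠ _) ≟ ⊥ᶠ       = no λ ()
(_ ∨ᶠ _) ≟ (_ ∧ᶠ _) = no λ ()
(_ ∨ᶠ _) ≟ (_ ⇒ᶠ _) = no λ ()
(φ ⇒ᶠ ψ) ≟ (χ ⇒ᶠ ω) = map′ (λ { (p , q) → ≡.cong₂ _⇒ᶠ_ p q }) (λ { refl → refl , refl }) ((φ ≟ χ) ×-dec (ψ ≟ ω))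
(_ ⇒ᶠ _) ≟ var _    = no λ ()
(_ ⇒ᶠ _) ≟ ⊤ᶠ       = no λ ()
(_ ⇒ᶠ _) ≟ ⊥ᶠ       = no λ ()
(_ ⇒ᶠ _) ≟ (_ ∧ᶠ _) = no λ ()
(_ ⇒ᶠ _) ≟ (_ ∨ᶠ _) = no λ ()

_∈?_ : (φ : Formula n) (Γ : List (Formula n)) → Dec (φ ∈ Γ)
_∈?_ = DecMembership._∈?_ _≟_

data _◁_ {n} : Formula n → Formula n → Set where
  ∧₁ : φ ◁ (φ ∧ᶠ ψ)
  ∧₂ : ψ ◁ (φ ∧ᶠ ψ)
  ∨₁ : φ ◁ (φ ∨ᶠ ψ)
  ∨₂ : ψ ◁ (φ ∨ᶠ ψ)
  ⇒₁ : φ ◁ (φ ⇒ᶠ ψ)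
  ⇒₂ : ψ ◁ (φ ⇒ᶠ ψ)

Closed : List (Formula n) → Set
Closed S = ∀ {φ ψ} → φ ◁ ψ → ψ ∈ S → φ ∈ S

++-closed : Closed Γ → Closed Δ → Closed (Γ ++ Δ)
++-closed {Γ = Γ} clΓ clΔ φ◁ψ m with ∈-++⁻ Γ m
... | inj₁ k = ∈-++⁺ˡ (clΓ φ◁ψ k)
... | inj₂ k = ∈-++⁺ʳ Γ (clΔ φ◁ψ k)

sub : Formula n → List (Formula n)
sub φ@(var _)  = φ ∷ []
sub ⊤ᶠ         = ⊤ᶠ ∷ []
sub ⊥ᶠ         = ⊥ᶠ ∷ []
sub (φ ∧ᶠ ψ)   = (φ ∧ᶠ ψ) ∷ sub φ ++ sub ψ
sub (φ ∨ᶠ ψ)   = (φ ∨ᶠ ψ) ∷ sub φ ++ sub ψ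
sub (φ ⇒ᶠ ψ)   = (φ ⇒ᶠ ψ) ∷ sub φ ++ sub ψ

∈-sub : (φ : Formula n) → φ ∈ sub φ
∈-sub (var _)  = here refl
∈-sub ⊤ᶠ       = here refl
∈-sub ⊥ᶠ       = here refl
∈-sub (_ ∧ᶠ _) = here refl
∈-sub (_ ∨ᶠ _) = here refl
∈-sub (_ ⇒ᶠ _) = here refl

sub-closed : (φ : Formula n) → Closed (sub φ)
sub-closed (var _)  () (here refl)
sub-closed ⊤ᶠ       () (here refl)
sub-closed ⊥ᶠ       () (here refl)
sub-closed (φ ∧ᶠ ψ) ∧₁ (here refl) = there (∈-++⁺ˡ (∈-sub φ))
sub-closed (φ ∧ᶠ ψ) ∧₂ (here refl) = there (∈-++⁺ʳ (sub φ) (∈-sub ψ))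
sub-closed (φ ∧ᶠ ψ) r  (there m)   = there (++-closed (sub-closed φ) (sub-closed ψ) r m)
sub-closed (φ ∨ᶠ ψ) ∨₁ (here refl) = there (∈-++⁺ˡ (∈-sub φ))
sub-closed (φ ∨ᶠ ψ) ∨₂ (here refl) = there (∈-++⁺ʳ (sub φ) (∈-sub ψ))
sub-closed (φ ∨ᶠ ψ) r  (there m)   = there (++-closed (sub-closed φ) (sub-closed ψ) r m)
sub-closed (φ ⇒ᶠ ψ) ⇒₁ (here refl) = there (∈-++⁺ˡ (∈-sub φ))
sub-closed (φ ⇒ᶠ ψ) ⇒₂ (here refl) = there (∈-++⁺ʳ (sub φ) (∈-sub ψ))
sub-closed (φ ⇒ᶠ ψ) r  (there m)   = there (++-closed (sub-closed φ) (sub-closed ψ) r m)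

-- The Kripke model of saturated pairs

-- A world of index (Γ , Δ) forces the formulas in Γ and refutes those in Δ.
SatL : (Γ Δ : List (Formula n)) → Formula n → Set
SatL Γ Δ (var i)  = var i ∉ Δ
SatL Γ Δ ⊤ᶠ       = Unit
SatL Γ Δ ⊥ᶠ       = Empty
SatL Γ Δ (φ ∧ᶠ ψ) = φ ∈ Γ × ψ ∈ Γ
SatL Γ Δ (φ ∨ᶠ ψ) = φ ∈ Γ ⊎ ψ ∈ Γ
SatL Γ Δ (φ ⇒ᶠ ψ) = φ ∈ Δ ⊎ ψ ∈ Γ

mutual
  -- A refuted implication needs a world above that forces its premise and refutes its conclusion:
  -- the same world for `stay`, a stored one for `climb`. Worlds are thereby well-founded trees.
  -- `⊤ᶠ` has no constructor, since it cannot be refuted.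
  data SatR {n} (Γ Δ : List (Formula n)) : Formula n → Set where
    varʳ  : ∀ {i} → SatR Γ Δ (var i)
    ⊥ʳ    : SatR Γ Δ ⊥ᶠ
    ∧ʳ    : φ ∈ Δ ⊎ ψ ∈ Δ → SatR Γ Δ (φ ∧ᶠ ψ)
    ∨ʳ    : φ ∈ Δ → ψ ∈ Δ → SatR Γ Δ (φ ∨ᶠ ψ)
    stay  : φ ∈ Γ → ψ ∈ Δ → SatR Γ Δ (φ ⇒ᶠ ψ)
    climb : World Γ′ Δ′ → Γ ⊆ Γ′ → φ ∈ Γ′ → ψ ∈ Δ′ → SatR Γ Δ (φ ⇒ᶠ ψ)

  data World {n} (Γ Δ : List (Formula n)) : Set where
    world : All (SatL Γ Δ) Γ → All (SatR Γ Δ) Δ → World Γ Δ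

satL : World Γ Δ → φ ∈ Γ → SatL Γ Δ φ
satL (world l r) = lookup l

satR : World Γ Δ → φ ∈ Δ → SatR Γ Δ φ
satR (world l r) = lookup r

infix 4 _⊩_

-- One Kripke model contains all saturated pairs, ordered by inclusion of their left components;
-- hence forcing depends on `Γ` alone.
_⊩_ : List (Formula n) → Formula n → Set
Γ ⊩ var i    = var i ∈ Γ
Γ ⊩ ⊤ᶠ       = Unit
Γ ⊩ ⊥ᶠ       = Empty
Γ ⊩ φ ∧ᶠ ψ   = Γ ⊩ φ × Γ ⊩ ψ
Γ ⊩ φ ∨ᶠ ψ   = Γ ⊩ φ ⊎ Γ ⊩ ψ
Γ ⊩ φ ⇒ᶠ ψ   = ∀ {Γ′ Δ′} → World Γ′ Δ′ → Γ ⊆ Γ′ → Γ′ ⊩ φ → Γ′ ⊩ ψ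

⊩-mono : ∀ φ → Γ ⊆ Γ′ → Γ ⊩ φ → Γ′ ⊩ φ
⊩-mono (var i)  ρ f        = ρ f
⊩-mono ⊤ᶠ       ρ f        = f
⊩-mono (φ ∧ᶠ ψ) ρ (f , g)  = ⊩-mono φ ρ f , ⊩-mono ψ ρ g
⊩-mono (φ ∨ᶠ ψ) ρ (inj₁ f) = inj₁ (⊩-mono φ ρ f)
⊩-mono (φ ∨ᶠ ψ) ρ (inj₂ f) = inj₂ (⊩-mono ψ ρ f)
⊩-mono (φ ⇒ᶠ ψ) ρ f        = λ w σ → f w (σ ∘ ρ)

⊩-sound : Γ ⊢ φ → World Γ′ Δ′ → (∀ {ψ} → ψ ∈ Γ → Γ′ ⊩ ψ) → Γ′ ⊩ φ
⊩-sound (hyp m)  w γ = γ m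
⊩-sound ⊤I       w γ = tt
⊩-sound (⊥E d)   w γ = ⊥-elim (⊩-sound d w γ)
⊩-sound (∧I d e) w γ = ⊩-sound d w γ , ⊩-sound e w γ
⊩-sound (∧E₁ d)  w γ = proj₁ (⊩-sound d w γ)
⊩-sound (∧E₂ d)  w γ = proj₂ (⊩-sound d w γ)
⊩-sound (∨I₁ d)  w γ = inj₁ (⊩-sound d w γ)
⊩-sound (∨I₂ d)  w γ = inj₂ (⊩-sound d w γ)
⊩-sound (∨E d e₁ e₂) w γ with ⊩-sound d w γ
... | inj₁ f = ⊩-sound e₁ w λ { (here refl) → f ; (there m) → γ m }
... | inj₂ f = ⊩-sound e₂ w λ { (here refl) → f ; (there m) → γ m }
⊩-sound (⇒I d)   w γ = λ w′ ρ f →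
  ⊩-sound d w′ λ { (here refl) → f ; {ψ} (there m) → ⊩-mono ψ ρ (γ m) }
⊩-sound (⇒E d e) w γ = ⊩-sound d w γ w id (⊩-sound e w γ)

mutual
  -- The truth lemma, by mutual induction with `refuted`. An implication in `Γ` persists to every
  -- world above, and saturation there either refutes its premise or forces its conclusion.
  forced : ∀ φ → World Γ Δ → φ ∈ Γ → Γ ⊩ φ
  forced (var i)  w m = m
  forced ⊤ᶠ       w m = tt
  forced ⊥ᶠ       w m = satL w m
  forced (φ ∧ᶠ ψ) w m with satL w m
  ... | k , l = forced φ w k , forced ψ w l
  forced (φ ∨ᶠ ψ) w m with satL w m
  ... | inj₁ k = inj₁ (forced φ w k)
  ... | inj₂ k = inj₂ (forced ψ w k)
  forced (φ ⇒ᶠ ψ) w m w′ ρ f with satL w′ (ρ m)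
  ... | inj₁ k = ⊥-elim (refuted φ w′ k f)
  ... | inj₂ k = forced ψ w′ k

  refuted : ∀ φ → World Γ Δ → φ ∈ Δ → ¬ (Γ ⊩ φ)
  refuted (var i)  w m f = satL w f m
  refuted ⊤ᶠ       w m f with satR w m
  ... | ()
  refuted (φ ∧ᶠ ψ) w m (f , g) with satR w m
  ... | ∧ʳ (inj₁ k) = refuted φ w k f
  ... | ∧ʳ (inj₂ k) = refuted ψ w k g
  refuted (φ ∨ᶠ ψ) w m f with satR w m | f
  ... | ∨ʳ k l | inj₁ g = refuted φ w k g
  ... | ∨ʳ k l | inj₂ g = refuted ψ w l g
  refuted (φ ⇒ᶠ ψ) w m f with satR w m
  ... | stay k l       = refuted ψ w l (f w id (forced φ w k))
  ... | climb w′ ρ k l = refuted ψ w′ l (f w′ ρ (forced φ w′ k))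

-- Primeness is the forcing clause for `∨ᶠ`; closure under derivability is soundness.
theory : {Γ Δ : List (Formula n)} → World Γ Δ → Es n
theory {Γ = Γ} w = record
  { _∋_    = Γ ⊩_
  ; upward = λ d f → ⊩-sound d w λ { (here refl) → f }
  ; top    = tt
  ; meet   = _,_
  ; proper = id
  ; prime  = id
  }

-- Terminating proof search

Countermodel : (Γ Δ : List (Formula n)) → Set
Countermodel Γ Δ = ∃₂ λ Γ′ Δ′ → World Γ′ Δ′ × Γ ⊆ Γ′ × Δ ⊆ Δ′

Decision : (Γ Δ : List (Formula n)) → Set
Decision Γ Δ = (Γ ⊢ ⋁ Δ) ⊎ Countermodel Γ Δ

shrink : Γ ⊆ Γ′ → Δ ⊆ Δ′ → Countermodel Γ′ Δ′ → Countermodel Γ Δ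
shrink ρ σ (_ , _ , w , ρ′ , σ′) = _ , _ , w , ρ′ ∘ ρ , σ′ ∘ σ

missing : (S Γ : List (Formula n)) → ℕ
missing []      Γ = 0
missing (φ ∷ S) Γ with φ ∈? Γ
... | yes _ = missing S Γ
... | no  _ = suc (missing S Γ)

missing-∷ : ∀ S (Γ : List (Formula n)) → missing S (φ ∷ Γ) ≤ missing S Γ
missing-∷ []              Γ = z≤n
missing-∷ {φ = φ} (ψ ∷ S) Γ with ψ ∈? Γ | ψ ∈? (φ ∷ Γ)
... | yes _ | yes _ = missing-∷ S Γ
... | yes m | no ∉∷ = contradiction (there m) ∉∷
... | no  _ | yes _ = ℕ.m≤n⇒m≤1+n (missing-∷ S Γ)
... | no  _ | no  _ = s≤s (missing-∷ S Γ)

missing-∷-< : ∀ {S} {Γ : List (Formula n)} → φ ∈ S → φ ∉ Γ → missing S (φ ∷ Γ) < missing S Γ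
missing-∷-< {φ = φ} {ψ ∷ S} {Γ} m ∉Γ with ψ ∈? Γ | ψ ∈? (φ ∷ Γ) | m
... | yes k | _     | here refl = contradiction k ∉Γ
... | no  _ | yes _ | here refl = s≤s (missing-∷ S Γ)
... | no  _ | no ∉∷ | here refl = contradiction (here refl) ∉∷
... | yes _ | yes _ | there k   = missing-∷-< k ∉Γ
... | yes l | no ∉∷ | there k   = contradiction (there l) ∉∷
... | no  _ | yes _ | there k   = ℕ.m≤n⇒m≤1+n (missing-∷-< k ∉Γ)
... | no  _ | no  _ | there k   = s≤s (missing-∷-< k ∉Γ)

module Search {n : ℕ} (S : List (Formula n)) (closed : Closed S) where

  record Bounded (g d : ℕ) (Γ Δ : List (Formula n)) : Set where
    field
      Γ⊆S : Γ ⊆ S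
      Δ⊆S : Δ ⊆ S
      g≥  : missing S Γ ≤ g
      d≥  : missing S Δ ≤ d
  open Bounded

  -- Termination is lexicographic in (g , d): a formula entering Γ lowers g, one entering Δ lowers d.
  mutual
    search : ∀ {g d Γ Δ} → Bounded g d Γ Δ → Decision Γ Δ
    search b with saturateL b _ id
    ... | inj₁ r = r
    ... | inj₂ l with saturateR b _ id
    ...   | inj₁ r = r
    ...   | inj₂ r = inj₂ (_ , _ , world l r , id , id)

    addL : ∀ {g d Γ Δ} → Bounded g d Γ Δ → φ ∈ S → φ ∉ Γ → Decision (φ ∷ Γ) Δ
    addL {g = zero}  b m ∉Γ = contradiction (ℕ.≤-trans (missing-∷-< m ∉Γ) (b .g≥)) ℕ.n≮0
    addL {g = suc g} b m ∉Γ = search {g = g} record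
      { Γ⊆S = ∈-∷⁺ʳ m (b .Γ⊆S) ; Δ⊆S = b .Δ⊆S
      ; g≥ = s≤s⁻¹ (ℕ.≤-trans (missing-∷-< m ∉Γ) (b .g≥)) ; d≥ = ℕ.≤-refl }

    addR : ∀ {g d Γ Δ} → Bounded g d Γ Δ → φ ∈ S → φ ∉ Δ → Decision Γ (φ ∷ Δ)
    addR {d = zero}  b m ∉Δ = contradiction (ℕ.≤-trans (missing-∷-< m ∉Δ) (b .d≥)) ℕ.n≮0
    addR {g = g} {d = suc d} b m ∉Δ = search {g = g} {d = d} record
      { Γ⊆S = b .Γ⊆S ; Δ⊆S = ∈-∷⁺ʳ m (b .Δ⊆S)
      ; g≥ = b .g≥ ; d≥ = s≤s⁻¹ (ℕ.≤-trans (missing-∷-< m ∉Δ) (b .d≥)) }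

    -- `X` lists the formulas of `Γ` still to be examined. An unsaturated one leads to larger
    -- sequents whose decisions settle the present one; if there is none, the left half of a world
    -- is complete.
    saturateL : ∀ {g d Γ Δ} → Bounded g d Γ Δ →
                ∀ X → X ⊆ Γ → Decision Γ Δ ⊎ All (SatL Γ Δ) X
    saturateL b []      X⊆Γ = inj₂ []
    saturateL b (χ ∷ X) X⊆Γ
      with stepL b χ (X⊆Γ (here refl))
    ... | inj₁ r = inj₁ r
    ... | inj₂ s with saturateL b X (X⊆Γ ∘ there)
    ...   | inj₁ r  = inj₁ r
    ...   | inj₂ ss = inj₂ (s ∷ ss)

    saturateR : ∀ {g d Γ Δ} → Bounded g d Γ Δ →
                ∀ X → X ⊆ Δ → Decision Γ Δ ⊎ All (SatR Γ Δ) X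
    saturateR b []      X⊆Δ = inj₂ []
    saturateR b (χ ∷ X) X⊆Δ
      with stepR b χ (X⊆Δ (here refl))
    ... | inj₁ r = inj₁ r
    ... | inj₂ s with saturateR b X (X⊆Δ ∘ there)
    ...   | inj₁ r  = inj₁ r
    ...   | inj₂ ss = inj₂ (s ∷ ss)

    stepL : ∀ {g d Γ Δ} → Bounded g d Γ Δ →
            ∀ χ → χ ∈ Γ → Decision Γ Δ ⊎ SatL Γ Δ χ
    stepL {Δ = Δ} b (var i) m with var i ∈? Δ
    ... | yes k = inj₁ (inj₁ (⋁-intro k (hyp m)))
    ... | no ∉Δ = inj₂ ∉Δ
    stepL b ⊤ᶠ m = inj₂ tt
    stepL b ⊥ᶠ m = inj₁ (inj₁ (⊥E (hyp m)))
    stepL {Γ = Γ} b (φ ∧ᶠ ψ) m with φ ∈? Γ | ψ ∈? Γ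
    ... | yes k | yes l = inj₂ (k , l)
    ... | no ∉Γ | _     with addL b (closed ∧₁ (b .Γ⊆S m)) ∉Γ
    ...   | inj₁ e = inj₁ (inj₁ (cut⊢ (∧E₁ (hyp m)) e))
    ...   | inj₂ c = inj₁ (inj₂ (shrink there id c))
    stepL b (φ ∧ᶠ ψ) m
        | yes _ | no ∉Γ with addL b (closed ∧₂ (b .Γ⊆S m)) ∉Γ
    ...   | inj₁ e = inj₁ (inj₁ (cut⊢ (∧E₂ (hyp m)) e))
    ...   | inj₂ c = inj₁ (inj₂ (shrink there id c))
    stepL {Γ = Γ} b (φ ∨ᶠ ψ) m with φ ∈? Γ | ψ ∈? Γ
    ... | yes k | _     = inj₂ (inj₁ k)
    ... | no _  | yes l = inj₂ (inj₂ l)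
    ... | no φ∉ | no ψ∉ with addL b (closed ∨₁ (b .Γ⊆S m)) φ∉
                           | addL b (closed ∨₂ (b .Γ⊆S m)) ψ∉
    ...   | inj₁ e₁ | inj₁ e₂ = inj₁ (inj₁ (∨E (hyp m) e₁ e₂))
    ...   | inj₂ c  | _       = inj₁ (inj₂ (shrink there id c))
    ...   | inj₁ _  | inj₂ c  = inj₁ (inj₂ (shrink there id c))
    stepL {Γ = Γ} {Δ} b (φ ⇒ᶠ ψ) m with φ ∈? Δ | ψ ∈? Γ
    ... | yes k | _     = inj₂ (inj₁ k)
    ... | no _  | yes l = inj₂ (inj₂ l)
    ... | no φ∉ | no ψ∉ with addR b (closed ⇒₁ (b .Γ⊆S m)) φ∉
                           | addL b (closed ⇒₂ (b .Γ⊆S m)) ψ∉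
    -- `e₁` yields `φ` or a formula of `Δ`; in the first case modus ponens supplies the `ψ` that
    -- `e₂` assumes.
    ...   | inj₁ e₁ | inj₁ e₂ = inj₁ (inj₁ (∨-absorb
              (cut⊢ (⇒E (hyp (there m)) (hyp (here refl))) (weaken (∷⁺ʳ _ there) e₂)) e₁))
    ...   | inj₂ c  | _       = inj₁ (inj₂ (shrink id there c))
    ...   | inj₁ _  | inj₂ c  = inj₁ (inj₂ (shrink there id c))

    stepR : ∀ {g d Γ Δ} → Bounded g d Γ Δ →
            ∀ χ → χ ∈ Δ → Decision Γ Δ ⊎ SatR Γ Δ χ
    stepR b (var i) m = inj₂ varʳ
    stepR b ⊤ᶠ m = inj₁ (inj₁ (⋁-intro m ⊤I))
    stepR b ⊥ᶠ m = inj₂ ⊥ʳ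
    stepR {Δ = Δ} b (φ ∧ᶠ ψ) m with φ ∈? Δ | ψ ∈? Δ
    ... | yes k | _     = inj₂ (∧ʳ (inj₁ k))
    ... | no _  | yes l = inj₂ (∧ʳ (inj₂ l))
    ... | no φ∉ | no ψ∉ with addR b (closed ∧₁ (b .Δ⊆S m)) φ∉
                           | addR b (closed ∧₂ (b .Δ⊆S m)) ψ∉
    ...   | inj₁ e₁ | inj₁ e₂ = inj₁ (inj₁ (∨-absorb (∨-absorb
              (⋁-intro m (∧I (hyp (there (here refl))) (hyp (here refl)))) (weaken₁ e₂)) e₁))
    ...   | inj₂ c  | _       = inj₁ (inj₂ (shrink id there c))
    ...   | inj₁ _  | inj₂ c  = inj₁ (inj₂ (shrink id there c))
    stepR {Δ = Δ} b (φ ∨ᶠ ψ) m with φ ∈? Δ | ψ ∈? Δ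
    ... | yes k | yes l = inj₂ (∨ʳ k l)
    ... | no ∉Δ | _     with addR b (closed ∨₁ (b .Δ⊆S m)) ∉Δ
    ...   | inj₁ e = inj₁ (inj₁ (∨-absorb (⋁-intro m (∨I₁ (hyp (here refl)))) e))
    ...   | inj₂ c = inj₁ (inj₂ (shrink id there c))
    stepR b (φ ∨ᶠ ψ) m
        | yes _ | no ∉Δ with addR b (closed ∨₂ (b .Δ⊆S m)) ∉Δ
    ...   | inj₁ e = inj₁ (inj₁ (∨-absorb (⋁-intro m (∨I₂ (hyp (here refl)))) e))
    ...   | inj₂ c = inj₁ (inj₂ (shrink id there c))
    stepR {Γ = Γ} b (φ ⇒ᶠ ψ) m with φ ∈? Γ
    stepR {Δ = Δ} b (φ ⇒ᶠ ψ) m | yes k with ψ ∈? Δ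
    ... | yes l = inj₂ (stay k l)
    ... | no ∉Δ with addR b (closed ⇒₂ (b .Δ⊆S m)) ∉Δ
    ...   | inj₁ e = inj₁ (inj₁ (∨-absorb (⋁-intro m (⇒I (hyp (there (here refl))))) e))
    ...   | inj₂ c = inj₁ (inj₂ (shrink id there c))
    stepR {g} b (φ ⇒ᶠ ψ) m | no ∉Γ
      -- A world above need not refute `Δ`, so the right side restarts as `ψ` alone. The second
      -- measure may grow here, because adding `φ` on the left lowers the first.
      with addL {g = g} {missing S (ψ ∷ [])} {Δ = ψ ∷ []} record
           { Γ⊆S = b .Γ⊆S ; Δ⊆S = λ { (here refl) → closed ⇒₂ (b .Δ⊆S m) } ; g≥ = b .g≥ ; d≥ = ℕ.≤-refl }
           (closed ⇒₁ (b .Δ⊆S m)) ∉Γ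
    ... | inj₁ e = inj₁ (inj₁ (⋁-intro m (⇒I (∨E e (hyp (here refl)) (⊥E (hyp (here refl)))))))
    ... | inj₂ (_ , _ , w , ρ , σ) =
            inj₂ (climb w (ρ ∘ there) (ρ (here refl)) (σ (here refl)))

-- A constructive prime filter theorem for free algebras: the search runs over the subformulas of
-- `φ` and `ψ`. Having the alternative as data makes the case distinctions below constructive.
separate : ∀ (φ ψ : Formula n) → φ ≤F ψ ⊎ Σ[ x ∈ Es n ] x ∈⟦ φ ∖ ψ ⟧
separate φ ψ
  with search {Γ = φ ∷ []} {ψ ∷ []} record
         { Γ⊆S = λ { (here refl) → ∈-++⁺ˡ (∈-sub φ) }
         ; Δ⊆S = λ { (here refl) → ∈-++⁺ʳ (sub φ) (∈-sub ψ) }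
         ; g≥ = ℕ.≤-refl ; d≥ = ℕ.≤-refl }
  where open Search (sub φ ++ sub ψ) (++-closed (sub-closed φ) (sub-closed ψ))
... | inj₁ d = inj₁ (∨E d (hyp (here refl)) (⊥E (hyp (here refl))))
... | inj₂ (_ , _ , w , ρ , σ) =
        inj₂ (theory w , forced φ w (ρ (here refl)) , refuted ψ w (σ (here refl)))

-- Discriminants as uniform interpolants

⋀⇒-elim : ∀ {D} → (φ , ψ) ∈ D → Γ ⊢ ⋀⇒ D → Γ ⊢ φ ⇒ᶠ ψ
⋀⇒-elim {D = _ ∷ _} (here refl) e = ∧E₁ e
⋀⇒-elim {D = _ ∷ _} (there m)   e = ⋀⇒-elim m (∧E₂ e)

⋀⇒-intro : ∀ D → (∀ {φ ψ} → (φ , ψ) ∈ D → Γ ⊢ φ ⇒ᶠ ψ) → Γ ⊢ ⋀⇒ D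
⋀⇒-intro []      h = ⊤I
⋀⇒-intro (_ ∷ D) h = ∧I (h (here refl)) (⋀⇒-intro D λ m → h (there m))

ι⋀⇒-intro : ∀ D → (∀ {φ ψ} → (φ , ψ) ∈ D → Γ ⊢ ι φ ⇒ᶠ ι ψ) → Γ ⊢ ι (⋀⇒ D)
ι⋀⇒-intro []      h = ⊤I
ι⋀⇒-intro (_ ∷ D) h = ∧I (h (here refl)) (ι⋀⇒-intro D λ m → h (there m))

∋-mp : (x : Es n) → x ∋ (φ ⇒ᶠ ψ) → x ∋ φ → x ∋ ψ
∋-mp x p q = upward x (⇒E (∧E₁ (hyp (here refl))) (∧E₂ (hyp (here refl)))) (meet x p q)

restrict : Es (suc n) → Es n
restrict x = record
  { _∋_    = λ φ → x ∋ ι φ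
  ; upward = λ d → upward x (ι-⊢ d)
  ; top    = top x
  ; meet   = meet x
  ; proper = proper x
  ; prime  = prime x
  }

-- `y` and the restriction of `x₀` lie in one ball, so comparing both with its centre gives the
-- agreement up to degree `R` that `IsR` asks for.
lift-point : IsR l d R → IsBall R (φ , ψ) →
  (y : Es l) → y ∈⟦ φ ∖ ψ ⟧ → (x₀ : Es (suc l)) → x₀ ∈⟦ ι φ ∖ ι ψ ⟧ →
  Σ[ x ∈ Es (suc l) ] Restr x y × x ∼⟨ d ⟩ x₀
lift-point isR (_ , _ , _ , ball) y y∈ x₀ x₀∈ = isR y x₀ λ χ χ≤R → mk⇔
  (λ p → from (to (ball y) y∈ χ χ≤R) (to (to (ball (restrict x₀)) x₀∈ χ χ≤R) p))
  (λ p → from (to (ball (restrict x₀)) x₀∈ χ χ≤R) (to (to (ball y) y∈ χ χ≤R) p))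

module _ {t : Formula (suc l)} {balls : List (Formula l × Formula l)} where

  discriminant-above : ∀ {Dt} → IsDiscList balls t Dt → t ≤F ι (⋀⇒ Dt)
  discriminant-above {Dt} disc = ι⋀⇒-intro Dt λ {φ} {ψ} m →
    ⇒I (cut⊢ (∧I (hyp (there (here refl))) (hyp (here refl)))
             (weaken (λ { (here refl) → here refl }) (proj₂ (to (disc φ ψ) m))))

  -- A prime filter containing `t` and `∇` but not `s` restricts into some ball. The filter itself
  -- witnesses that this ball belongs to `D′`, so `∇` contains `φ ⇒ᶠ ψ`, which excludes the
  -- restriction from the ball.
  codiscriminant-below : ∀ {s D′} → BallSystem l R balls → IsCoDiscList balls t s D′ →
    (t ∧ᶠ ι (⋀⇒ D′)) ≤F s
  codiscriminant-below {s = s} {D′} system codisc with separate (t ∧ᶠ ι (⋀⇒ D′)) s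
  ... | inj₁ e = e
  ... | inj₂ (x , x∋t∧∇ , x∌s) with proj₂ system (restrict x)
  ... | (φ , ψ) , m , x∋φ , x∌ψ = contradiction (∋-mp (restrict x) x∋φ⇒ψ x∋φ) x∌ψ
    where
    in-D′ : (φ , ψ) ∈ D′
    in-D′ = from (codisc φ ψ) (m , λ e → [ x∌s , x∌ψ ]′
      (prime x (upward x e (meet x (upward x (∧E₁ (hyp (here refl))) x∋t∧∇) x∋φ))))

    x∋φ⇒ψ : restrict x ∋ (φ ⇒ᶠ ψ)
    x∋φ⇒ψ = upward (restrict x) (⋀⇒-elim in-D′ (hyp (here refl)))
              (upward x (∧E₂ (hyp (here refl))) x∋t∧∇)

  module _ (isR : IsR l d R) (t≤d : deg t ≤ d) (system : BallSystem l R balls) where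

    -- Together with discriminant-above: Δ_t is the uniform interpolant ∃q t.
    discriminant-least : ∀ {Dt} → IsDiscList balls t Dt → t ≤F ι θ → ⋀⇒ Dt ≤F θ
    discriminant-least {θ = θ} {Dt} disc t≤θ with separate (⋀⇒ Dt) θ
    ... | inj₁ e = e
    ... | inj₂ (y , y∋Δ , y∌θ) with proj₂ system y
    ... | (φ , ψ) , m , y∋φ , y∌ψ with separate (t ∧ᶠ ι φ) (ι ψ)
    ... | inj₁ e = contradiction
            (∋-mp y (upward y (⋀⇒-elim (from (disc φ ψ) (m , e)) (hyp (here refl))) y∋Δ) y∋φ) y∌ψ
    ... | inj₂ (x₀ , x₀∋t∧φ , x₀∌ψ)
        with lift-point isR (proj₁ system m) y (y∋φ , y∌ψ) x₀
               (upward x₀ (∧E₂ (hyp (here refl))) x₀∋t∧φ , x₀∌ψ)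
    -- The degree bound matters only for carrying `t` from `x₀` to `x`; `θ` may have any degree
    -- because `x` restricts to `y` exactly.
    ... | x , x↓y , x∼x₀ = contradiction (to (x↓y θ) (upward x t≤θ x∋t)) y∌θ
      where
      x∋t : x ∋ t
      x∋t = from (x∼x₀ t t≤d) (upward x₀ (∧E₁ (hyp (here refl))) x₀∋t∧φ)

    -- Together with codiscriminant-below: ∇_{t,s} is the uniform interpolant ∀q (t → s).
    codiscriminant-greatest : ∀ {s D′} → deg s ≤ d → IsCoDiscList balls t s D′ →
      (t ∧ᶠ ι θ) ≤F s → θ ≤F ⋀⇒ D′
    codiscriminant-greatest {θ = θ} {s} {D′} s≤d codisc t∧θ≤s = ⋀⇒-intro D′ member
      where
      member : (φ , ψ) ∈ D′ → θ ∷ [] ⊢ φ ⇒ᶠ ψ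
      member {φ} {ψ} m with separate (θ ∧ᶠ φ) ψ
      ... | inj₁ e = ⇒I (cut⊢ (∧I (hyp (there (here refl))) (hyp (here refl)))
                              (weaken (λ { (here refl) → here refl }) e))
      ... | inj₂ (y , y∋θ∧φ , y∌ψ) with to (codisc φ ψ) m | separate (t ∧ᶠ ι φ) (s ∨ᶠ ι ψ)
      ... | _ , ≰ | inj₁ e = contradiction e ≰
      ... | m′ , _ | inj₂ (x₀ , x₀∋t∧φ , x₀∌s∨ψ)
          with lift-point isR (proj₁ system m′) y
                 (upward y (∧E₂ (hyp (here refl))) y∋θ∧φ , y∌ψ) x₀
                 (upward x₀ (∧E₂ (hyp (here refl))) x₀∋t∧φ ,
                  λ p → x₀∌s∨ψ (upward x₀ (∨I₂ (hyp (here refl))) p))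
      -- `x` receives `t` from `x₀` and `θ` from `y`, hence contains `s`; the bound on `deg s`
      -- carries `s` back to `x₀`.
      ... | x , x↓y , x∼x₀ = contradiction
              (upward x₀ (∨I₁ (hyp (here refl))) (to (x∼x₀ s s≤d) (upward x t∧θ≤s (meet x x∋t x∋θ)))) x₀∌s∨ψ
        where
        x∋t : x ∋ t
        x∋t = from (x∼x₀ t t≤d) (upward x₀ (∧E₁ (hyp (here refl))) x₀∋t∧φ)

        x∋θ : x ∋ ι θ
        x∋θ = from (x↓y θ) (upward y (∧E₁ (hyp (here refl))) y∋θ∧φ)

-- A cut-free sequent calculus over arbitrary atoms

infixr 7 _⊓_
infixr 6 _⊔_
infixr 5 _⇀_

data Fm {v} (V : Set v) : Set v where
  at          : V → Fm V
  𝟏 𝟎         : Fm V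
  _⊓_ _⊔_ _⇀_ : Fm V → Fm V → Fm V

module Sequent {v τ} {V : Set v} (T : Fm V → Set τ) where

  private variable
    w : V
    α β γ : Fm V
    Π Λ : List (Fm V)

  infix 3 _⟹_ _∈ᵀ_ _⊆ᵀ_

  -- Axioms of `T` count as members of every antecedent, so left rules act on them directly and cut
  -- elimination works for arbitrary `T`.
  _∈ᵀ_ : Fm V → List (Fm V) → Set (v ⊔ℓ τ)
  α ∈ᵀ Π = T α ⊎ α ∈ Π

  data _⟹_ : List (Fm V) → Fm V → Set (v ⊔ℓ τ) where
    ax  : at w ∈ᵀ Π → Π ⟹ at w
    𝟏R  : Π ⟹ 𝟏
    𝟎L  : 𝟎 ∈ᵀ Π → Π ⟹ γ
    ⊓R  : Π ⟹ α → Π ⟹ β → Π ⟹ α ⊓ β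
    ⊓L  : α ⊓ β ∈ᵀ Π → α ∷ β ∷ Π ⟹ γ → Π ⟹ γ
    ⊔R₁ : Π ⟹ α → Π ⟹ α ⊔ β
    ⊔R₂ : Π ⟹ β → Π ⟹ α ⊔ β
    ⊔L  : α ⊔ β ∈ᵀ Π → α ∷ Π ⟹ γ → β ∷ Π ⟹ γ → Π ⟹ γ
    ⇀R  : α ∷ Π ⟹ β → Π ⟹ α ⇀ β
    ⇀L  : α ⇀ β ∈ᵀ Π → Π ⟹ α → β ∷ Π ⟹ γ → Π ⟹ γ

  _⊆ᵀ_ : List (Fm V) → List (Fm V) → Set (v ⊔ℓ τ)
  Π ⊆ᵀ Λ = ∀ {α} → α ∈ Π → α ∈ᵀ Λ

  ∈ᵀ-mono : Π ⊆ᵀ Λ → α ∈ᵀ Π → α ∈ᵀ Λ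
  ∈ᵀ-mono ρ = [ inj₁ , ρ ]′

  extend : Π ⊆ᵀ Λ → α ∷ Π ⊆ᵀ α ∷ Λ
  extend ρ (here e)  = inj₂ (here e)
  extend ρ (there m) = [ inj₁ , (λ k → inj₂ (there k)) ]′ (ρ m)

  ⊆ᵀ-there : Π ⊆ᵀ α ∷ Π
  ⊆ᵀ-there m = inj₂ (there m)

  -- The inclusion covers weakening, exchange, contraction and the removal of hypotheses that are
  -- axioms.
  wk : Π ⊆ᵀ Λ → Π ⟹ γ → Λ ⟹ γ
  wk ρ (ax m)     = ax (∈ᵀ-mono ρ m)
  wk ρ 𝟏R         = 𝟏R
  wk ρ (𝟎L m)     = 𝟎L (∈ᵀ-mono ρ m)
  wk ρ (⊓R D E)   = ⊓R (wk ρ D) (wk ρ E)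
  wk ρ (⊓L m D)   = ⊓L (∈ᵀ-mono ρ m) (wk (extend (extend ρ)) D)
  wk ρ (⊔R₁ D)    = ⊔R₁ (wk ρ D)
  wk ρ (⊔R₂ D)    = ⊔R₂ (wk ρ D)
  wk ρ (⊔L m D E) = ⊔L (∈ᵀ-mono ρ m) (wk (extend ρ) D) (wk (extend ρ) E)
  wk ρ (⇀R D)     = ⇀R (wk (extend ρ) D)
  wk ρ (⇀L m D E) = ⇀L (∈ᵀ-mono ρ m) (wk ρ D) (wk (extend ρ) E)

  wk₁ : Π ⟹ γ → α ∷ Π ⟹ γ
  wk₁ = wk ⊆ᵀ-there

  identity : ∀ α → α ∈ᵀ Π → Π ⟹ α
  identity (at w)  m = ax m
  identity 𝟏       m = 𝟏R
  identity 𝟎       m = 𝟎L m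
  identity (α ⊓ β) m = ⊓L m (⊓R (identity α (inj₂ (here refl))) (identity β (inj₂ (there (here refl)))))
  identity (α ⊔ β) m = ⊔L m (⊔R₁ (identity α (inj₂ (here refl)))) (⊔R₂ (identity β (inj₂ (here refl))))
  identity (α ⇀ β) m = ⇀R (⇀L (∈ᵀ-mono ⊆ᵀ-there m)
    (identity α (inj₂ (here refl))) (identity β (inj₂ (here refl))))

  -- The premises of a left rule with principal formula α and conclusion Π ⟹ γ;
  -- atoms count as having none, since cutting against an axiom needs no reduction.
  Premises : Fm V → List (Fm V) → Fm V → Set (v ⊔ℓ τ)
  Premises (at w)  Π γ = EmptyP
  Premises 𝟏       Π γ = EmptyP
  Premises 𝟎       Π γ = UnitP
  Premises (α ⊓ β) Π γ = α ∷ β ∷ Π ⟹ γ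
  Premises (α ⊔ β) Π γ = (α ∷ Π ⟹ γ) × (β ∷ Π ⟹ γ)
  Premises (α ⇀ β) Π γ = (Π ⟹ α) × (β ∷ Π ⟹ γ)

  wk-premises : ∀ α → Π ⊆ᵀ Λ → Premises α Π γ → Premises α Λ γ
  wk-premises 𝟎       ρ P       = P
  wk-premises (α ⊓ β) ρ D       = wk (extend (extend ρ)) D
  wk-premises (α ⊔ β) ρ (D , E) = wk (extend ρ) D , wk (extend ρ) E
  wk-premises (α ⇀ β) ρ (D , E) = wk ρ D , wk (extend ρ) E

  exchange : Λ ⊆ᵀ α ∷ Π → β ∷ Λ ⊆ᵀ α ∷ β ∷ Π
  exchange ρ (here refl) = inj₂ (there (here refl))
  exchange ρ (there m) with ρ m
  ... | inj₁ k         = inj₁ k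
  ... | inj₂ (here e)  = inj₂ (here e)
  ... | inj₂ (there k) = inj₂ (there (there k))

  locate : Λ ⊆ᵀ α ∷ Π → β ∈ᵀ Λ → β ≡ α ⊎ β ∈ᵀ Π
  locate ρ m with ∈ᵀ-mono ρ m
  ... | inj₁ k         = inj₂ (inj₁ k)
  ... | inj₂ (here e)  = inj₁ e
  ... | inj₂ (there k) = inj₂ (inj₂ k)

  module Reduce (α : Fm V)
    (principal : ∀ {Π γ} → Π ⟹ α → Premises α Π γ → Π ⟹ γ) where

    -- Induction on the second derivation. Left rules keep their principal formula, so `α` is first
    -- cut out of the premises; if `α` was principal, `principal` finishes. The inclusion lets `α`
    -- occur anywhere in `Λ`.
    reduce : Π ⟹ α → Λ ⟹ γ → Λ ⊆ᵀ α ∷ Π → Π ⟹ γ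
    reduce D (ax m) ρ with locate ρ m
    ... | inj₁ refl = D
    ... | inj₂ k    = ax k
    reduce D 𝟏R ρ = 𝟏R
    reduce D (𝟎L m) ρ with locate ρ m
    ... | inj₁ refl = principal D _
    ... | inj₂ k    = 𝟎L k
    reduce D (⊓R E F) ρ = ⊓R (reduce D E ρ) (reduce D F ρ)
    reduce D (⊓L m E) ρ with locate ρ m | reduce (wk₁ (wk₁ D)) E (exchange (exchange ρ))
    ... | inj₁ refl | E′ = principal D E′
    ... | inj₂ k    | E′ = ⊓L k E′
    reduce D (⊔R₁ E) ρ = ⊔R₁ (reduce D E ρ)
    reduce D (⊔R₂ E) ρ = ⊔R₂ (reduce D E ρ)
    reduce D (⊔L m E F) ρ
      with locate ρ m | reduce (wk₁ D) E (exchange ρ) | reduce (wk₁ D) F (exchange ρ)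
    ... | inj₁ refl | E′ | F′ = principal D (E′ , F′)
    ... | inj₂ k    | E′ | F′ = ⊔L k E′ F′
    reduce D (⇀R E) ρ = ⇀R (reduce (wk₁ D) E (exchange ρ))
    reduce D (⇀L m E F) ρ with locate ρ m | reduce D E ρ | reduce (wk₁ D) F (exchange ρ)
    ... | inj₁ refl | E′ | F′ = principal D (E′ , F′)
    ... | inj₂ k    | E′ | F′ = ⇀L k E′ F′

    cut-by : Π ⟹ α → α ∷ Π ⟹ γ → Π ⟹ γ
    cut-by D E = reduce D E inj₂

  open Reduce using (cut-by)

  -- Follows the first derivation up to the right rule introducing `α` and replaces the cut by cuts
  -- on immediate subformulas. The recursion is on `α`, then on that derivation.
  principal : ∀ α → Π ⟹ α → Premises α Π γ → Π ⟹ γ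
  principal α       (𝟎L m)     P       = 𝟎L m
  principal α       (⊓L m D)   P       = ⊓L m (principal α D (wk-premises α (λ k → inj₂ (there (there k))) P))
  principal α       (⊔L m D E) P       = ⊔L m (principal α D (wk-premises α ⊆ᵀ-there P))
                                              (principal α E (wk-premises α ⊆ᵀ-there P))
  principal α       (⇀L m D E) P       = ⇀L m D (principal α E (wk-premises α ⊆ᵀ-there P))
  principal (α ⊓ β) (⊓R D E)   F       =
    cut-by β (principal β) E (cut-by α (principal α) (wk₁ D) F)
  principal (α ⊔ β) (⊔R₁ D)    (E , F) = cut-by α (principal α) D E
  principal (α ⊔ β) (⊔R₂ D)    (E , F) = cut-by β (principal β) D F
  principal (α ⇀ β) (⇀R D)     (E , F) = cut-by β (principal β) (cut-by α (principal α) E D) F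

  cut : Π ⟹ α → α ∷ Π ⟹ γ → Π ⟹ γ
  cut {α = α} = cut-by α (principal α)

-- Soundness of IPC in Heyting algebras

module HeytingEntailment {c ℓ₁ ℓ₂} (A : HeytingAlgebra c ℓ₁ ℓ₂) where
  open HeytingAlgebra A renaming (_≤_ to _≤A_; refl to ≤-refl)
  open HeytingProperties A using (swap-transpose-⇨)

  private variable
    r x y z : Carrier

  ∧-elim₁ : r ≤A x ∧ y → r ≤A x
  ∧-elim₁ p = trans p (x∧y≤x _ _)

  ∧-elim₂ : r ≤A x ∧ y → r ≤A y
  ∧-elim₂ p = trans p (x∧y≤y _ _)

  ∨-intro₁ : r ≤A x → r ≤A x ∨ y
  ∨-intro₁ p = trans p (x≤x∨y _ _)

  ∨-intro₂ : r ≤A y → r ≤A x ∨ y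
  ∨-intro₂ p = trans p (y≤x∨y _ _)

  ∨-elim : r ≤A x ∨ y → x ∧ r ≤A z → y ∧ r ≤A z → r ≤A z
  ∨-elim p q₁ q₂ = trans (∧-greatest p ≤-refl)
    (transpose-∧ (∨-least (transpose-⇨ q₁) (transpose-⇨ q₂)))

  ⇨-intro : x ∧ r ≤A y → r ≤A x ⇨ y
  ⇨-intro = swap-transpose-⇨

  ⇨-elim : r ≤A x ⇨ y → r ≤A x → r ≤A y
  ⇨-elim p q = trans (∧-greatest p q) (transpose-∧ ≤-refl)

  ⊢-sound : ∀ {Γ} {φ : Formula n} {v} → Γ ⊢ φ →
            (∀ {ψ} → ψ ∈ Γ → r ≤A ⟦ A ⟧ ψ v) → r ≤A ⟦ A ⟧ φ v
  ⊢-sound (hyp m)  γ = γ m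
  ⊢-sound ⊤I       γ = maximum _
  ⊢-sound (⊥E d)   γ = trans (⊢-sound d γ) (minimum _)
  ⊢-sound (∧I d e) γ = ∧-greatest (⊢-sound d γ) (⊢-sound e γ)
  ⊢-sound (∧E₁ d)  γ = ∧-elim₁ (⊢-sound d γ)
  ⊢-sound (∧E₂ d)  γ = ∧-elim₂ (⊢-sound d γ)
  ⊢-sound (∨I₁ d)  γ = ∨-intro₁ (⊢-sound d γ)
  ⊢-sound (∨I₂ d)  γ = ∨-intro₂ (⊢-sound d γ)
  ⊢-sound (∨E d e₁ e₂) γ = ∨-elim (⊢-sound d γ)
    (⊢-sound e₁ λ { (here refl) → x∧y≤x _ _ ; (there m) → trans (x∧y≤y _ _) (γ m) })
    (⊢-sound e₂ λ { (here refl) → x∧y≤x _ _ ; (there m) → trans (x∧y≤y _ _) (γ m) })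
  ⊢-sound (⇒I d)   γ = ⇨-intro
    (⊢-sound d λ { (here refl) → x∧y≤x _ _ ; (there m) → trans (x∧y≤y _ _) (γ m) })
  ⊢-sound (⇒E d e) γ = ⇨-elim (⊢-sound d γ) (⊢-sound e γ)

  ≤F-sound : ∀ {φ ψ : Formula n} {v} → φ ≤F ψ → ⟦ A ⟧ φ v ≤A ⟦ A ⟧ ψ v
  ≤F-sound d = ⊢-sound d λ { (here refl) → ≤-refl }

module _ {c ℓ₁ ℓ₂ c′ ℓ₁′ ℓ₂′} {A : HeytingAlgebra c ℓ₁ ℓ₂} {B : HeytingAlgebra c′ ℓ₁′ ℓ₂′}
         (emb : Embedding A B) (a : Fin l → HeytingAlgebra.Carrier A)
         (b : HeytingAlgebra.Carrier B) where
  open HeytingAlgebra B using (_≈_; module Eq; joinSemilattice; meetSemilattice)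
  open Embedding emb

  ι-eval : ∀ φ → ⟦ B ⟧ (ι φ) (extVal emb a b) ≈ f (⟦ A ⟧ φ a)
  ι-eval (var i)  = Eq.refl
  ι-eval ⊤ᶠ       = Eq.sym pres-⊤
  ι-eval ⊥ᶠ       = Eq.sym pres-⊥
  ι-eval (φ ∧ᶠ ψ) = Eq.trans (MeetProperties.∧-cong meetSemilattice (ι-eval φ) (ι-eval ψ)) (Eq.sym (pres-∧ _ _))
  ι-eval (φ ∨ᶠ ψ) = Eq.trans (JoinProperties.∨-cong joinSemilattice (ι-eval φ) (ι-eval ψ)) (Eq.sym (pres-∨ _ _))
  ι-eval (φ ⇒ᶠ ψ) = Eq.trans (HeytingProperties.⇨-cong B (ι-eval φ) (ι-eval ψ)) (Eq.sym (pres-⇨ _ _))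

-- The Lindenbaum algebra of a theory

lindenbaum : ∀ {v τ} {V : Set v} → (Fm V → Set τ) → HeytingAlgebra v (v ⊔ℓ τ) (v ⊔ℓ τ)
lindenbaum {V = V} T = record
  { Carrier = Fm V
  ; _≈_ = λ α β → (α ∷ [] ⟹ β) × (β ∷ [] ⟹ α)
  ; _≤_ = λ α β → α ∷ [] ⟹ β
  ; _∨_ = _⊔_
  ; _∧_ = _⊓_
  ; _⇨_ = _⇀_
  ; ⊤ = 𝟏
  ; ⊥ = 𝟎
  ; isHeytingAlgebra = record
    { isBoundedLattice = record
      { isLattice = record
        { isPartialOrder = record
          { isPreorder = record
            { isEquivalence = record
              { refl  = first , first
              ; sym   = swap
              ; trans = λ (D , D′) (E , E′) → chain D E , chain E′ D′
              }
            ; reflexive = proj₁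
            ; trans = chain
            }
          ; antisym = _,_
          }
        ; supremum = λ _ _ → ⊔R₁ first , ⊔R₂ first , λ _ D E →
            ⊔L (inj₂ (here refl)) (wk head D) (wk head E)
        ; infimum = λ _ _ → ⊓L (inj₂ (here refl)) first , ⊓L (inj₂ (here refl)) second , λ _ → ⊓R
        }
      ; maximum = λ _ → 𝟏R
      ; minimum = λ _ → 𝟎L (inj₂ (here refl))
      }
    ; exponential = λ _ _ _ →
        (λ D → ⇀R (cut (⊓R second first) (wk head D))) ,
        (λ D → ⊓L (inj₂ (here refl)) (cut (wk head D) (⇀L (inj₂ (here refl))
                 (identity _ (inj₂ (there (there (here refl))))) first)))
    }
  }
  where
  open Sequent T

  first : ∀ {α Γ} → α ∷ Γ ⟹ α
  first = identity _ (inj₂ (here refl))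

  second : ∀ {α β Γ} → β ∷ α ∷ Γ ⟹ α
  second = identity _ (inj₂ (there (here refl)))

  head : ∀ {α Γ} → α ∷ [] ⊆ᵀ α ∷ Γ
  head (here refl) = inj₂ (here refl)

  chain : ∀ {α β γ} → α ∷ [] ⟹ β → β ∷ [] ⟹ γ → α ∷ [] ⟹ γ
  chain D E = cut D (wk head E)

-- The extension A[q]/t

module FreeExtension {c ℓ₁ ℓ₂} (A : HeytingAlgebra c ℓ₁ ℓ₂)
                     (a : Fin l → HeytingAlgebra.Carrier A) (t : Formula (suc l)) where
  open HeytingAlgebra A renaming (_≤_ to _≤A_; refl to ≤-refl)
  open HeytingEntailment A

  -- nothing is q, and just x names x ∈ A; Left α φ says that α is φ(ā,q).
  data Left : Fm (Maybe Carrier) → Formula (suc l) → Set c where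
    q    : Left (at nothing) (var zero)
    p    : ∀ {x} i → a i ≡ x → Left (at (just x)) (var (suc i))
    𝟏ˡ   : Left 𝟏 ⊤ᶠ
    𝟎ˡ   : Left 𝟎 ⊥ᶠ
    _⊓ˡ_ : ∀ {α β φ ψ} → Left α φ → Left β ψ → Left (α ⊓ β) (φ ∧ᶠ ψ)
    _⊔ˡ_ : ∀ {α β φ ψ} → Left α φ → Left β ψ → Left (α ⊔ β) (φ ∨ᶠ ψ)
    _⇀ˡ_ : ∀ {α β φ ψ} → Left α φ → Left β ψ → Left (α ⇀ β) (φ ⇒ᶠ ψ)

  -- Right α x says that α is free of q and has value x in A.
  data Right : Fm (Maybe Carrier) → Carrier → Set c where
    elt  : ∀ x → Right (at (just x)) x
    𝟏ʳ   : Right 𝟏 ⊤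
    𝟎ʳ   : Right 𝟎 ⊥
    _⊓ʳ_ : ∀ {α β x y} → Right α x → Right β y → Right (α ⊓ β) (x ∧ y)
    _⊔ʳ_ : ∀ {α β x y} → Right α x → Right β y → Right (α ⊔ β) (x ∨ y)
    _⇀ʳ_ : ∀ {α β x y} → Right α x → Right β y → Right (α ⇀ β) (x ⇨ y)

  -- The axioms are `t` at ā, q together with the diagram of `A`: all q-free formulas of value `⊤`.
  Theory : Fm (Maybe Carrier) → Set (c ⊔ℓ ℓ₂)
  Theory α = Left α t ⊎ Σ[ x ∈ Carrier ] Right α x × ⊤ ≤A x

  open Sequent Theory

  -- Interpolation between IPC and `A`

  data Side (α : Fm (Maybe Carrier)) : Set c where
    left  : ∀ {φ} → Left α φ → Side α
    right : ∀ {x} → Right α x → Side α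

  -- The theory belongs to every antecedent, so the left side ends in `t`; the diagram contributes
  -- only the value `⊤` with which `rights` ends.
  lefts : ∀ {Γ} → All Side Γ → List (Formula (suc l))
  lefts []                    = t ∷ []
  lefts (left {φ = φ} _ ∷ S)  = φ ∷ lefts S
  lefts (right _ ∷ S)         = lefts S

  rights : ∀ {Γ} → All Side Γ → Carrier
  rights []                    = ⊤
  rights (left _ ∷ S)          = rights S
  rights (right {x = x} _ ∷ S) = x ∧ rights S

  -- Asks for entailment by a side instead of membership in it, so that axioms and hypotheses are
  -- treated alike.
  data Located {Γ} (S : All Side Γ) (α : Fm (Maybe Carrier)) : Set (c ⊔ℓ ℓ₂) where
    onLeft  : ∀ {φ} → Left α φ → lefts S ⊢ φ → Located S α
    onRight : ∀ {x} → Right α x → rights S ≤A x → Located S α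

  t∈lefts : ∀ {Γ} (S : All Side Γ) → t ∈ lefts S
  t∈lefts []            = here refl
  t∈lefts (left _ ∷ S)  = there (t∈lefts S)
  t∈lefts (right _ ∷ S) = t∈lefts S

  find : ∀ {Γ α} (S : All Side Γ) → α ∈ᵀ Γ → Located S α
  find S (inj₁ (inj₁ L))           = onLeft L (hyp (t∈lefts S))
  find S (inj₁ (inj₂ (x , r , ≥))) = onRight r (trans (maximum _) ≥)
  find (left L ∷ S)  (inj₂ (here refl)) = onLeft L (hyp (here refl))
  find (right r ∷ S) (inj₂ (here refl)) = onRight r (x∧y≤x _ _)
  find (left L ∷ S)  (inj₂ (there m)) with find S (inj₂ m)
  ... | onLeft L′ e = onLeft L′ (weaken₁ e)
  ... | onRight r e = onRight r e
  find (right r ∷ S) (inj₂ (there m)) with find S (inj₂ m)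
  ... | onLeft L e   = onLeft L e
  ... | onRight r′ e = onRight r′ (trans (x∧y≤y _ _) e)

  ⟪_⟫ : Formula l → Carrier
  ⟪ φ ⟫ = ⟦ A ⟧ φ a

  private
    h₀ : ∀ {φ : Formula n} {Γ} → φ ∷ Γ ⊢ φ
    h₀ = hyp (here refl)

    under : ∀ {φ ψ χ : Formula n} {Γ} → φ ∷ Γ ⊢ χ → φ ∷ ψ ∷ Γ ⊢ χ
    under = weaken (∷⁺ʳ _ there)

    under₂ : ∀ {φ ψ χ ω : Formula n} {Γ} → φ ∷ ψ ∷ Γ ⊢ χ → φ ∷ ψ ∷ ω ∷ Γ ⊢ χ
    under₂ = weaken (∷⁺ʳ _ (∷⁺ʳ _ there))

    flip⊢ : ∀ {φ ψ χ : Formula n} {Γ} → φ ∷ ψ ∷ Γ ⊢ χ → ψ ∷ φ ∷ Γ ⊢ χ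
    flip⊢ = weaken λ { (here refl) → there (here refl) ; (there (here refl)) → here refl
                     ; (there (there m)) → there (there m) }

    fst≤ : ∀ {x r} → x ∧ r ≤A x
    fst≤ = x∧y≤x _ _

    snd≤ : ∀ {x r} → x ∧ r ≤A r
    snd≤ = x∧y≤y _ _

  -- The left side is judged by derivability in IPC, the right side by the order of `A`; `I`
  -- mediates as a formula in p̄ evaluated at ā.
  Interpolantᴿ : ∀ {Γ} → All Side Γ → Carrier → Set ℓ₂
  Interpolantᴿ S z = Σ[ I ∈ Formula l ] (lefts S ⊢ ι I) × ⟪ I ⟫ ∧ rights S ≤A z

  Interpolantᴸ : ∀ {Γ} → All Side Γ → Formula (suc l) → Set ℓ₂
  Interpolantᴸ S φ = Σ[ I ∈ Formula l ] rights S ≤A ⟪ I ⟫ × (ι I ∷ lefts S ⊢ φ)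

  -- Maehara's method: I follows from the part of the antecedent on the side opposite to the goal.
  mutual
    interpolateᴿ : ∀ {Γ γ z} → Γ ⟹ γ → (S : All Side Γ) → Right γ z → Interpolantᴿ S z
    interpolateᴿ (ax m) S (elt x) with find S m
    ... | onLeft (p i refl) e = var i , e , fst≤
    ... | onRight (elt _) e   = ⊤ᶠ , ⊤I , trans snd≤ e
    interpolateᴿ 𝟏R S 𝟏ʳ = ⊤ᶠ , ⊤I , maximum _
    interpolateᴿ (𝟎L m) S r with find S m
    ... | onLeft 𝟎ˡ e  = ⊥ᶠ , e , trans fst≤ (minimum _)
    ... | onRight 𝟎ʳ e = ⊤ᶠ , ⊤I , trans snd≤ (trans e (minimum _))
    interpolateᴿ (⊓R D E) S (r ⊓ʳ r′) with interpolateᴿ D S r | interpolateᴿ E S r′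
    ... | I , d , e | J , d′ , e′ = I ∧ᶠ J , ∧I d d′ ,
      ∧-greatest (trans (∧-greatest (∧-elim₁ fst≤) snd≤) e) (trans (∧-greatest (∧-elim₂ fst≤) snd≤) e′)
    interpolateᴿ (⊓L m D) S r with find S m
    ... | onLeft (L ⊓ˡ L′) f with interpolateᴿ D (left L ∷ left L′ ∷ S) r
    ...   | I , d , e = I , cut⊢ (∧E₂ f) (cut⊢ (weaken₁ (∧E₁ f)) d) , e
    interpolateᴿ (⊓L m D) S r
        | onRight (R ⊓ʳ R′) f with interpolateᴿ D (right R ∷ right R′ ∷ S) r
    ...   | I , d , e = I , d , trans (∧-greatest fst≤
              (∧-greatest (∧-elim₁ (trans snd≤ f)) (∧-greatest (∧-elim₂ (trans snd≤ f)) snd≤))) e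
    interpolateᴿ (⊔R₁ D) S (r ⊔ʳ r′) with interpolateᴿ D S r
    ... | I , d , e = I , d , ∨-intro₁ e
    interpolateᴿ (⊔R₂ D) S (r ⊔ʳ r′) with interpolateᴿ D S r′
    ... | I , d , e = I , d , ∨-intro₂ e
    interpolateᴿ (⊔L m D E) S r with find S m
    ... | onLeft (L ⊔ˡ L′) f
        with interpolateᴿ D (left L ∷ S) r | interpolateᴿ E (left L′ ∷ S) r
    -- A case split on the side opposite to the goal gives one interpolant per case, hence a
    -- disjunction; a split on the goal's side uses both, hence a conjunction.
    ...   | I , d , e | J , d′ , e′ = I ∨ᶠ J , ∨E f (∨I₁ d) (∨I₂ d′) ,
              ∨-elim fst≤ (trans (∧-greatest fst≤ (∧-elim₂ snd≤)) e) (trans (∧-greatest fst≤ (∧-elim₂ snd≤)) e′)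
    interpolateᴿ (⊔L m D E) S r
        | onRight (R ⊔ʳ R′) f
        with interpolateᴿ D (right R ∷ S) r | interpolateᴿ E (right R′ ∷ S) r
    ...   | I , d , e | J , d′ , e′ = I ∧ᶠ J , ∧I d d′ ,
              ∨-elim (trans snd≤ f)
                (trans (∧-greatest (∧-elim₁ (∧-elim₁ snd≤)) (∧-greatest fst≤ (∧-elim₂ snd≤))) e)
                (trans (∧-greatest (∧-elim₂ (∧-elim₁ snd≤)) (∧-greatest fst≤ (∧-elim₂ snd≤))) e′)
    interpolateᴿ (⇀R D) S (r ⇀ʳ r′) with interpolateᴿ D (right r ∷ S) r′
    ... | I , d , e = I , d , ⇨-intro (trans (∧-greatest (∧-elim₁ snd≤) (∧-greatest fst≤ (∧-elim₂ snd≤))) e)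
    interpolateᴿ (⇀L m D E) S r with find S m
    ... | onLeft (L ⇀ˡ L′) f
        with interpolateᴸ D S L | interpolateᴿ E (left L′ ∷ S) r
    -- The minor premise has its goal on the other side, so `I` flows in the opposite direction to
    -- `J` and becomes the premise of an implication.
    ...   | I , e , d | J , d′ , e′ = I ⇒ᶠ J , ⇒I (cut⊢ (⇒E (weaken₁ f) d) (under d′)) ,
              trans (∧-greatest (⇨-elim fst≤ (trans snd≤ e)) snd≤) e′
    interpolateᴿ (⇀L m D E) S r
        | onRight (R ⇀ʳ R′) f
        with interpolateᴿ D S R | interpolateᴿ E (right R′ ∷ S) r
    ...   | I , d , e | J , d′ , e′ = I ∧ᶠ J , ∧I d d′ ,
              trans (∧-greatest (∧-elim₂ fst≤) (∧-greatest
                (⇨-elim (trans snd≤ f) (trans (∧-greatest (∧-elim₁ fst≤) snd≤) e)) snd≤)) e′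

    interpolateᴸ : ∀ {Γ γ φ} → Γ ⟹ γ → (S : All Side Γ) → Left γ φ → Interpolantᴸ S φ
    interpolateᴸ (ax m) S q with find S m
    ... | onLeft q e = ⊤ᶠ , maximum _ , weaken₁ e
    interpolateᴸ (ax m) S (p i refl) with find S m
    -- ā may repeat an element, so p_i and p_j can name the same atom.
    ... | onLeft (p j eq) e = var j ⇒ᶠ var i ,
            ⇨-intro (trans fst≤ (reflexive (Eq.reflexive eq))) , ⇒E h₀ (weaken₁ e)
    ... | onRight (elt _) e = var i , e , h₀
    interpolateᴸ 𝟏R S 𝟏ˡ = ⊤ᶠ , maximum _ , ⊤I
    interpolateᴸ (𝟎L m) S L with find S m
    ... | onLeft 𝟎ˡ e  = ⊤ᶠ , maximum _ , ⊥E (weaken₁ e)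
    ... | onRight 𝟎ʳ e = ⊥ᶠ , e , ⊥E h₀
    interpolateᴸ (⊓R D E) S (L ⊓ˡ L′) with interpolateᴸ D S L | interpolateᴸ E S L′
    ... | I , e , d | J , e′ , d′ = I ∧ᶠ J , ∧-greatest e e′ ,
      ∧I (cut⊢ (∧E₁ h₀) (under d)) (cut⊢ (∧E₂ h₀) (under d′))
    interpolateᴸ (⊓L m D) S L with find S m
    ... | onLeft (K ⊓ˡ K′) f with interpolateᴸ D (left K ∷ left K′ ∷ S) L
    ...   | I , e , d = I , e , cut⊢ (weaken₁ (∧E₂ f)) (cut⊢ (weaken₁ (weaken₁ (∧E₁ f)))
              (weaken (λ { (here refl) → there (there (here refl)) ; (there (here refl)) → here refl
                         ; (there (there (here refl))) → there (here refl)
                         ; (there (there (there k))) → there (there (there k)) }) d))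
    interpolateᴸ (⊓L m D) S L
        | onRight (R ⊓ʳ R′) f with interpolateᴸ D (right R ∷ right R′ ∷ S) L
    ...   | I , e , d = I , trans (∧-greatest (∧-elim₁ f) (∧-greatest (∧-elim₂ f) ≤-refl)) e , d
    interpolateᴸ (⊔R₁ D) S (L ⊔ˡ L′) with interpolateᴸ D S L
    ... | I , e , d = I , e , ∨I₁ d
    interpolateᴸ (⊔R₂ D) S (L ⊔ˡ L′) with interpolateᴸ D S L′
    ... | I , e , d = I , e , ∨I₂ d
    interpolateᴸ (⊔L m D E) S L with find S m
    ... | onLeft (K ⊔ˡ K′) f
        with interpolateᴸ D (left K ∷ S) L | interpolateᴸ E (left K′ ∷ S) L
    ...   | I , e , d | J , e′ , d′ = I ∧ᶠ J , ∧-greatest e e′ ,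
              ∨E (weaken₁ f) (cut⊢ (weaken₁ (∧E₁ h₀)) (under₂ d)) (cut⊢ (weaken₁ (∧E₂ h₀)) (under₂ d′))
    interpolateᴸ (⊔L m D E) S L
        | onRight (R ⊔ʳ R′) f
        with interpolateᴸ D (right R ∷ S) L | interpolateᴸ E (right R′ ∷ S) L
    ...   | I , e , d | J , e′ , d′ = I ∨ᶠ J ,
              ∨-elim f (∨-intro₁ e) (∨-intro₂ e′) , ∨E h₀ (under d) (under d′)
    interpolateᴸ (⇀R D) S (L ⇀ˡ L′) with interpolateᴸ D (left L ∷ S) L′
    ... | I , e , d = I , e , ⇒I (flip⊢ d)
    interpolateᴸ (⇀L m D E) S L with find S m
    ... | onLeft (K ⇀ˡ K′) f
        with interpolateᴸ D S K | interpolateᴸ E (left K′ ∷ S) L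
    ...   | I , e , d | J , e′ , d′ = I ∧ᶠ J , ∧-greatest e e′ ,
              cut⊢ (⇒E (weaken₁ f) (cut⊢ (∧E₁ h₀) (under d))) (cut⊢ (weaken₁ (∧E₂ h₀)) (under₂ d′))
    interpolateᴸ (⇀L m D E) S L
        | onRight (R ⇀ʳ R′) f
        with interpolateᴿ D S R | interpolateᴸ E (right R′ ∷ S) L
    ...   | I , d , e | J , e′ , d′ = I ⇒ᶠ J ,
              ⇨-intro (trans (∧-greatest (⇨-elim (trans snd≤ f) e) snd≤) e′) ,
              cut⊢ (⇒E h₀ (weaken₁ d)) (under d′)

  -- The embedding of `A` and the generic solution

  B : HeytingAlgebra c (c ⊔ℓ ℓ₂) (c ⊔ℓ ℓ₂)
  B = lindenbaum Theory

  name : Carrier → Fm (Maybe Carrier)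
  name x = at (just x)

  -- The inequality gives `α ⇀ β` the value `⊤`, so it is an axiom. Applied to a name and a compound
  -- formula of equal value, this makes `name` a homomorphism.
  diagram : ∀ {α β x y} → Right α x → Right β y → x ≤A y → α ∷ [] ⟹ β
  diagram R R′ x≤y = ⇀L (inj₁ (inj₂ (_ , R ⇀ʳ R′ , ⇨-intro (trans fst≤ x≤y))))
    (identity _ (inj₂ (here refl))) (identity _ (inj₂ (here refl)))

  diagram-≈ : ∀ {α β x} → Right α x → Right β x → HeytingAlgebra._≈_ B α β
  diagram-≈ R R′ = diagram R R′ ≤-refl , diagram R′ R ≤-refl

  module _ (conservative : ∀ {θ} → t ≤F ι θ → ⊤ ≤A ⟪ θ ⟫) where

    -- With `name x` on the right, the left side is `t` alone. The interpolant is thus above `t`,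
    -- has value `⊤` by `conservative`, and drops out of the inequality.
    name-reflects-≤ : ∀ {x y} → name x ∷ [] ⟹ name y → x ≤A y
    name-reflects-≤ {x} D with interpolateᴿ D (right (elt x) ∷ []) (elt _)
    ... | I , d , e = trans (∧-greatest (trans (maximum _) (conservative d))
                                        (∧-greatest ≤-refl (maximum _))) e

    embedding : Embedding A B
    embedding = record
      { f         = name
      ; cong      = λ x≈y → diagram (elt _) (elt _) (reflexive x≈y) ,
                            diagram (elt _) (elt _) (reflexive (Eq.sym x≈y))
      ; injective = λ (D , E) → antisym (name-reflects-≤ D) (name-reflects-≤ E)
      ; pres-∧    = λ x y → diagram-≈ (elt _) (elt x ⊓ʳ elt y)
      ; pres-∨    = λ x y → diagram-≈ (elt _) (elt x ⊔ʳ elt y)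
      ; pres-⇨    = λ x y → diagram-≈ (elt _) (elt x ⇀ʳ elt y)
      ; pres-⊤    = diagram-≈ (elt _) 𝟏ʳ
      ; pres-⊥    = diagram-≈ (elt _) 𝟎ʳ
      }

    valuation : Fin (suc l) → Fm (Maybe Carrier)
    valuation = extVal embedding a (at nothing)

    eval-left : ∀ φ → Left (⟦ B ⟧ φ valuation) φ
    eval-left (var zero)    = q
    eval-left (var (suc i)) = p i refl
    eval-left ⊤ᶠ            = 𝟏ˡ
    eval-left ⊥ᶠ            = 𝟎ˡ
    eval-left (φ ∧ᶠ ψ)      = eval-left φ ⊓ˡ eval-left ψ
    eval-left (φ ∨ᶠ ψ)      = eval-left φ ⊔ˡ eval-left ψ
    eval-left (φ ⇒ᶠ ψ)      = eval-left φ ⇀ˡ eval-left ψ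

    t-holds : HeytingAlgebra._≈_ B (⟦ B ⟧ t valuation) 𝟏
    t-holds = 𝟏R , identity _ (inj₁ (inj₁ (eval-left t)))

    -- Placing the antecedent `𝟏` on the right leaves `t` as the whole left side and makes the right
    -- side `⊤ ∧ ⊤`.
    holds-interpolant : ∀ s → HeytingAlgebra._≈_ B (⟦ B ⟧ s valuation) 𝟏 →
      Σ[ I ∈ Formula l ] ⊤ ≤A ⟪ I ⟫ × ((t ∧ᶠ ι I) ≤F s)
    holds-interpolant s (_ , D) with interpolateᴸ D (right 𝟏ʳ ∷ []) (eval-left s)
    ... | I , e , d = I , trans (∧-greatest ≤-refl ≤-refl) e ,
      cut⊢ (∧E₁ h₀) (cut⊢ (weaken₁ (∧E₂ h₀))
        (weaken (λ { (here refl) → here refl ; (there (here refl)) → there (here refl) }) d))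

-- Solvability in terms of the discriminants

theorem6p1 : ∀ {c ℓ₁ ℓ₂ : Level} (l d κ R : ℕ) → IsR l d R →
    (t : Formula (suc l)) (s : Fin (suc κ) → Formula (suc l)) →
    deg t ≤ d → (∀ k → deg (s k) ≤ d) →
    (balls : List (Formula l × Formula l)) → BallSystem l R balls →
    (Dt : List (Formula l × Formula l)) → IsDiscList balls t Dt →
    (D' : Fin (suc κ) → List (Formula l × Formula l)) →
    (∀ k → IsCoDiscList balls t (s k) (D' k)) →
    (A : HeytingAlgebra c ℓ₁ ℓ₂) (a : Fin l → HeytingAlgebra.Carrier A) →
    HasSolution A a t s
    ⇔ω (HeytingAlgebra._≈_ A (⟦ A ⟧ (⋀⇒ Dt) a) (HeytingAlgebra.⊤ A)
    × (∀ k → ¬ HeytingAlgebra._≈_ A (⟦ A ⟧ (⋀⇒ (D' k)) a) (HeytingAlgebra.⊤ A)))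
theorem6p1 l d κ R isR t s t≤d s≤d balls system Dt disc D′ codisc A a = record
  { to = forward ; from = λ (Δ≈⊤ , ∇≉⊤) → backward Δ≈⊤ ∇≉⊤ }
  where
  open HeytingAlgebra A renaming (_≤_ to _≤A_)

  forward : HasSolution A a t s → ⟦ A ⟧ (⋀⇒ Dt) a ≈ ⊤ × (∀ k → ¬ ⟦ A ⟧ (⋀⇒ (D′ k)) a ≈ ⊤)
  -- Both interpolant inequalities are evaluated in the extension, where `t` is 1: the first makes Δ
  -- equal to 1 there and injectivity returns this to `A`; by the second, a ∇ equal to 1 would force
  -- `s k` to be 1.
  forward sol = injective Δ≈⊤ , λ k ∇≈⊤ → s-sol k (B.antisym (B.maximum _)
      (B.trans (B.∧-greatest (B.reflexive (B.Eq.sym t-sol)) (B.reflexive (⊤≈∇ k ∇≈⊤)))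
               (≤F-sound (codiscriminant-below system (codisc k)))))
    where
    open HasSolution sol
    open Embedding emb
    open HeytingEntailment B using (≤F-sound)
    module B = HeytingAlgebra B

    Δ≈⊤ : f (⟦ A ⟧ (⋀⇒ Dt) a) B.≈ f ⊤
    Δ≈⊤ = B.Eq.trans
      (B.antisym (B.maximum _) (B.trans (B.reflexive (B.Eq.sym t-sol))
        (B.trans (≤F-sound (discriminant-above disc)) (B.reflexive (ι-eval emb a b (⋀⇒ Dt))))))
      (B.Eq.sym pres-⊤)

    ⊤≈∇ : ∀ k → ⟦ A ⟧ (⋀⇒ (D′ k)) a ≈ ⊤ → B.⊤ B.≈ ⟦ B ⟧ (ι (⋀⇒ (D′ k))) (extVal emb a b)
    ⊤≈∇ k ∇≈⊤ = B.Eq.trans (B.Eq.sym pres-⊤)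
      (B.Eq.trans (cong (Eq.sym ∇≈⊤)) (B.Eq.sym (ι-eval emb a b (⋀⇒ (D′ k)))))

  backward : ⟦ A ⟧ (⋀⇒ Dt) a ≈ ⊤ → (∀ k → ¬ ⟦ A ⟧ (⋀⇒ (D′ k)) a ≈ ⊤) → HasSolution A a t s
  backward Δ≈⊤ ∇≉⊤ = record
    { B     = Ext.B
    ; emb   = Ext.embedding conservative
    ; b     = at nothing
    ; t-sol = Ext.t-holds conservative
    ; s-sol = λ k s≈⊤ → let (I , ⊤≤I , t∧I≤s) = Ext.holds-interpolant conservative (s k) s≈⊤ in
        -- The interpolant has value `⊤` and lies below ∇, the greatest formula whose meet with `t`
        -- is below `s k`.
        ∇≉⊤ k (antisym (maximum _) (trans ⊤≤I
          (≤F-sound (codiscriminant-greatest isR t≤d system (s≤d k) (codisc k) t∧I≤s))))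
    }
    where
    module Ext = FreeExtension A a t
    open HeytingEntailment A using (≤F-sound)

    conservative : ∀ {θ} → t ≤F ι θ → ⊤ ≤A ⟦ A ⟧ θ a
    conservative t≤θ = trans (reflexive (Eq.sym Δ≈⊤))
      (≤F-sound (discriminant-least isR t≤d system disc t≤θ))
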